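{- There is a polynomial-time algorithm with oracle access to a decision oracle for PCE which, on input two permutationally equivalent $[n,k,d]_q$ codes $\mathcal{C}_1,\mathcal{C}_2$ (given by generator matrices $G,F\in\mathbb{F}_q^{k\times n}$), solves search-PCE, i.e. outputs a permutation $\pi\in\mathcal{S}_n$ with $\pi(\mathcal{C}_1)=\mathcal{C}_2$ (equivalently, a permutation matrix $P$ for which there exists $S\in\mathrm{GL}_k(\mathbb{F}_q)$ with $SGP=F$). The algorithm makes at most $n^2$ calls to the PCE oracle, and each call is on a pair of codes over $\mathbb{F}_q$ of dimension $k$ and length at most $n^2(n+1)/2$.
   Context: $\mathbb{F}_q$ is the finite field with $q$ elements. An $[n,k,d]_q$ code is a $k$-dimensional $\mathbb{F}_q$-subspace of $\mathbb{F}_q^n$ whose minimum nonzero Hamming weight is $d$; $n$ is its length and $k$ its dimension. A generator matrix of such a code is a matrix in $\mathbb{F}_q^{k\times n}$ whose rows span the code. $\mathcal{S}_n$ is the group of permutations of $\{1,\dots,n\}$, acting on $\mathbb{F}_q^n$ by permuting coordinates: $\pi(x)=y$ with $y_{\pi(i)}=x_i$. PCE (Permutation Code Equivalence, decision problem): given two $[n,k,d]_q$ codes $\mathcal{C}_1,\mathcal{C}_2$ by generator matrices $G_1,G_2$, decide whether there is $\pi\in\mathcal{S}_n$ with $\mathcal{C}_2=\pi(\mathcal{C}_1)$; equivalently whether there are $S\in\mathrm{GL}_k(\mathbb{F}_q)$ and an $n\times n$ permutation matrix $P$ with $G_2=SG_1P$. Two codes for which the answer is positive are called permutationally equivalent.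 search-PCE: given two permutationally equivalent codes, find such a $\pi$. Polynomial time means polynomial in the size of the input, each oracle call counting as one step. -}

module Defs where

open import Algebra.Bundles using (CommutativeRing)
open import Data.Bool.Base using (Bool; true; false)
open import Data.Fin.Base using (Fin; toℕ)
import Data.Fin.Properties as Fin
open import Data.Fin.Permutation using (Permutation′; _⟨$⟩ʳ_; _⟨$⟩ˡ_)
open import Data.List.Base as List using (List; []; _∷_; _++_)
open import Data.Nat.Base using (ℕ; zero; suc; _+_; _≤_)
open import Data.Nat.Binary.Base using (ℕᵇ; zero; 2[1+_]; 1+[2_]; fromℕ)
open import Data.Product.Base using (Σ; ∃; _×_)
open import Data.Vec.Base as Vec using (Vec; _∷_; lookup; _[_]≔_)
open import Data.Vec.Functional using (Vector)
import Data.Vec.Functional.Relation.Binary.Equality.Setoid as VectorEquality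
import Algebra.Properties.Semiring.Sum as Sum
open import Function.Base using (_∘_)
open import Function.Bundles using (Bijection; _⇔_)
open import Level using (Level; _⊔_) renaming (suc to lsuc)
open import Relation.Binary.Definitions using (Decidable)
open import Relation.Binary.PropositionalEquality.Core using (_≡_)
open import Relation.Binary.PropositionalEquality.Properties using (setoid)
open import Relation.Nullary.Decidable using (¬?; via-injection)
open import Relation.Nullary.Negation using (¬_)
open import Relation.Unary using (Pred; _∈_; _≐_)

------------------------------------------------------------------------
-- Oracle computation.
--
-- The machine model is Jones's WHILE language over binary trees,
-- extended with an oracle instruction.  A program has a fixed number of
-- variables; the only operations are the tree constructors and selectors,
-- each of unit cost, and a test looks only at the root of a tree.  With
-- common subtrees shared in memory, such a program is simulated by
-- a Turing machine with polynomial overhead, and conversely.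

data 𝔻 : Set where
  nil  : 𝔻
  cons : 𝔻 → 𝔻 → 𝔻

size : 𝔻 → ℕ
size nil        = 1
size (cons a b) = 1 + (size a + size b)

data Expr (v : ℕ) : Set where
  var   : Fin v → Expr v
  nil   : Expr v
  cons  : Expr v → Expr v → Expr v
  hd tl : Expr v → Expr v

data Com (v : ℕ) : Set where
  _:=_          : Fin v → Expr v → Com v
  _:=oracle_    : Fin v → Expr v → Com v
  _⨾_           : Com v → Com v → Com v
  if_then_else_ : Expr v → Com v → Com v → Com v
  while_loop_     : Expr v → Com v → Com v

infixr 5 _⨾_
infix  6 _:=_ _:=oracle_ if_then_else_ while_loop_

Store : ℕ → Set
Store = Vec 𝔻

head𝔻 tail𝔻 : 𝔻 → 𝔻
head𝔻 nil        = nil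
head𝔻 (cons a b) = a
tail𝔻 nil        = nil
tail𝔻 (cons a b) = b

eval : ∀ {v} → Expr v → Store v → 𝔻
eval (var x)      σ = lookup σ x
eval nil          σ = nil
eval (cons e₁ e₂) σ = cons (eval e₁ σ) (eval e₂ σ)
eval (hd e)       σ = head𝔻 (eval e σ)
eval (tl e)       σ = tail𝔻 (eval e σ)

cost : ∀ {v} → Expr v → ℕ
cost (var x)      = 1
cost nil          = 1
cost (cons e₁ e₂) = 1 + (cost e₁ + cost e₂)
cost (hd e)       = 1 + cost e
cost (tl e)       = 1 + cost e

Oracle : Set
Oracle = 𝔻 → Bool

encodeBool : Bool → 𝔻
encodeBool false = nil
encodeBool true  = cons nil nil

-- O ⊢⟨ p ∣ σ ⟩⇓⟨ σ′ ∣ t ∣ qs ⟩: with oracle O, the command p started in store σ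
-- halts in store σ′ after t steps, having queried O on exactly the trees
-- qs, in this order.  A tree is true as a test iff it is not nil.

infix 4 _⊢⟨_∣_⟩⇓⟨_∣_∣_⟩

data _⊢⟨_∣_⟩⇓⟨_∣_∣_⟩ (O : Oracle) {v : ℕ} :
       Com v → Store v → Store v → ℕ → List 𝔻 → Set where

  assign : ∀ {x e σ} →
    O ⊢⟨ x := e ∣ σ ⟩⇓⟨ σ [ x ]≔ eval e σ ∣ 1 + cost e ∣ [] ⟩

  call : ∀ {x e σ} →
    O ⊢⟨ x :=oracle e ∣ σ ⟩⇓⟨ σ [ x ]≔ encodeBool (O (eval e σ))
                              ∣ 1 + cost e ∣ eval e σ ∷ [] ⟩

  seq : ∀ {p₁ p₂ σ σ′ σ″ t₁ t₂ qs₁ qs₂} →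
    O ⊢⟨ p₁ ∣ σ ⟩⇓⟨ σ′ ∣ t₁ ∣ qs₁ ⟩ →
    O ⊢⟨ p₂ ∣ σ′ ⟩⇓⟨ σ″ ∣ t₂ ∣ qs₂ ⟩ →
    O ⊢⟨ p₁ ⨾ p₂ ∣ σ ⟩⇓⟨ σ″ ∣ t₁ + t₂ ∣ qs₁ ++ qs₂ ⟩

  if-true : ∀ {e p₁ p₂ σ σ′ a b t qs} →
    eval e σ ≡ cons a b →
    O ⊢⟨ p₁ ∣ σ ⟩⇓⟨ σ′ ∣ t ∣ qs ⟩ →
    O ⊢⟨ if e then p₁ else p₂ ∣ σ ⟩⇓⟨ σ′ ∣ 1 + cost e + t ∣ qs ⟩

  if-false : ∀ {e p₁ p₂ σ σ′ t qs} →
    eval e σ ≡ nil →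
    O ⊢⟨ p₂ ∣ σ ⟩⇓⟨ σ′ ∣ t ∣ qs ⟩ →
    O ⊢⟨ if e then p₁ else p₂ ∣ σ ⟩⇓⟨ σ′ ∣ 1 + cost e + t ∣ qs ⟩

  while-true : ∀ {e p σ σ′ σ″ a b t₁ t₂ qs₁ qs₂} →
    eval e σ ≡ cons a b →
    O ⊢⟨ p ∣ σ ⟩⇓⟨ σ′ ∣ t₁ ∣ qs₁ ⟩ →
    O ⊢⟨ while e loop p ∣ σ′ ⟩⇓⟨ σ″ ∣ t₂ ∣ qs₂ ⟩ →
    O ⊢⟨ while e loop p ∣ σ ⟩⇓⟨ σ″ ∣ 1 + cost e + (t₁ + t₂) ∣ qs₁ ++ qs₂ ⟩

  while-false : ∀ {e p σ} →
    eval e σ ≡ nil →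
    O ⊢⟨ while e loop p ∣ σ ⟩⇓⟨ σ ∣ 1 + cost e ∣ [] ⟩

-- The first variable holds the input at the start and the output at the
-- end; the others are initially nil.

record Program : Set where
  field
    extraVars : ℕ
    body      : Com (suc extraVars)

Runs : Oracle → Program → (input output : 𝔻) → (t : ℕ) → (qs : List 𝔻) → Set
Runs O A input output t qs = ∃ λ (σ : Store extraVars) →
  O ⊢⟨ body ∣ input ∷ Vec.replicate extraVars nil ⟩⇓⟨ output ∷ σ ∣ t ∣ qs ⟩
  where open Program A

encodeList : List 𝔻 → 𝔻
encodeList = List.foldr cons nil

encodeVector : ∀ {a} {A : Set a} → (A → 𝔻) → ∀ {n} → Vector A n → 𝔻
encodeVector enc x = encodeList (List.tabulate (enc ∘ x))

encodeUnary : ℕ → 𝔻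
encodeUnary zero    = nil
encodeUnary (suc n) = cons nil (encodeUnary n)

encodeBinary : ℕᵇ → 𝔻
encodeBinary zero     = nil
encodeBinary 2[1+ b ] = cons nil (encodeBinary b)
encodeBinary 1+[2 b ] = cons (cons nil nil) (encodeBinary b)

-- The list π(0), …, π(n-1), with entries in unary.

encodePermutation : ∀ {n} → Permutation′ n → 𝔻
encodePermutation π = encodeVector (encodeUnary ∘ toℕ) (π ⟨$⟩ʳ_)

------------------------------------------------------------------------
-- Finite fields

-- The enumeration is arbitrary; it fixes how elements are named on the
-- machine.

record FiniteField (c ℓ : Level) (q : ℕ) : Set (lsuc (c ⊔ ℓ)) where
  field
    commutativeRing : CommutativeRing c ℓ

  open CommutativeRing commutativeRing public
    renaming (_+_ to _+ᶠ_; _*_ to _*ᶠ_; setoid to setoidᶠ)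

  field
    1≉0         : ¬ 1# ≈ 0#
    inverse     : ∀ x → ¬ x ≈ 0# → ∃ λ y → x *ᶠ y ≈ 1#
    enumeration : Bijection setoidᶠ (setoid (Fin q))

  index : Carrier → Fin q
  index = Bijection.to enumeration

  _≟_ : Decidable _≈_
  _≟_ = via-injection (Bijection.injection enumeration) Fin._≟_

------------------------------------------------------------------------
-- Linear codes

module Codes {c ℓ : Level} {q : ℕ} (𝔽 : FiniteField c ℓ q) where

  open FiniteField 𝔽
  open VectorEquality setoidᶠ using (_≋_)
  open Sum semiring using (sum)

  Word : ℕ → Set c
  Word n = Vector Carrier n

  Subset : ℕ → Set (lsuc (c ⊔ ℓ))
  Subset n = Pred (Word n) (c ⊔ ℓ)

  -- G i j is the entry in row i and column j.

  Matrix : ℕ → ℕ → Set c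
  Matrix k n = Vector (Word n) k

  0ʷ : ∀ {n} → Word n
  0ʷ _ = 0#

  _+ʷ_ : ∀ {n} → Word n → Word n → Word n
  (x +ʷ y) j = x j +ᶠ y j

  _*ʷ_ : ∀ {n} → Carrier → Word n → Word n
  (a *ʷ x) j = a *ᶠ x j

  combination : ∀ {k n} → Vector Carrier k → Matrix k n → Word n
  combination a G j = sum (λ i → a i *ᶠ G i j)

  rowSpan : ∀ {k n} → Matrix k n → Subset n
  rowSpan G x = ∃ λ a → x ≋ combination a G

  LinearlyIndependent : ∀ {k n} → Matrix k n → Set (c ⊔ ℓ)
  LinearlyIndependent G =
    ∀ a → combination a G ≋ 0ʷ → ∀ i → a i ≈ 0#

  record IsSubspace {n} (C : Subset n) : Set (c ⊔ ℓ) where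
    field
      resp     : ∀ {x y} → x ≋ y → x ∈ C → y ∈ C
      0-closed : 0ʷ ∈ C
      +-closed : ∀ {x y} → x ∈ C → y ∈ C → (x +ʷ y) ∈ C
      *-closed : ∀ a {x} → x ∈ C → (a *ʷ x) ∈ C

  record IsBasis {k n} (B : Matrix k n) (C : Subset n) : Set (c ⊔ ℓ) where
    field
      independent : LinearlyIndependent B
      spanning    : C ≐ rowSpan B

  record Code (n k : ℕ) : Set (lsuc (c ⊔ ℓ)) where
    field
      words      : Subset n
      isSubspace : IsSubspace words
      basis      : Matrix k n
      isBasis    : IsBasis basis words

  open Code public using (words)

  weight : ∀ {n} → Word n → ℕ
  weight x = Vec.count (λ a → ¬? (a ≟ 0#)) (Vec.tabulate x)

  record HasMinimumDistance {n k} (C : Code n k) (d : ℕ) : Set (c ⊔ ℓ) where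
    field
      attained : ∃ λ x → x ∈ words C × ¬ x ≋ 0ʷ × weight x ≡ d
      minimal  : ∀ x → x ∈ words C → ¬ x ≋ 0ʷ → d ≤ weight x

  Generates : ∀ {n k} → Matrix k n → Code n k → Set (c ⊔ ℓ)
  Generates G C = words C ≐ rowSpan G

  -- permute π x has entry x i at position π(i).

  permute : ∀ {n} → Permutation′ n → Word n → Word n
  permute π x j = x (π ⟨$⟩ˡ j)

  image : ∀ {n} → Permutation′ n → Subset n → Subset n
  image π C y = ∃ λ x → x ∈ C × y ≋ permute π x

  Maps : ∀ {n k} → Permutation′ n → Code n k → Code n k → Set (c ⊔ ℓ)
  Maps π C₁ C₂ = image π (words C₁) ≐ words C₂

  PermutationallyEquivalent : ∀ {n k} → Code n k → Code n k → Set (c ⊔ ℓ)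
  PermutationallyEquivalent C₁ C₂ = ∃ λ π → Maps π C₁ C₂

  encodeElement : Carrier → 𝔻
  encodeElement a = encodeBinary (fromℕ (toℕ (index a)))

  -- Column by column, so that n can be read off even when k = 0.

  encodeMatrix : ∀ {k n} → Matrix k n → 𝔻
  encodeMatrix G = encodeVector (encodeVector encodeElement) (λ j i → G i j)

  encodeInstance : ∀ {k n} → Matrix k n → Matrix k n → 𝔻
  encodeInstance G₁ G₂ = cons (encodeMatrix G₁) (encodeMatrix G₂)

  -- Nothing is assumed about trees that encode no pair of generator
  -- matrices.  Codes with different minimum distances are inequivalent, so
  -- such pairs are negative instances.

  DecidesPCE : Oracle → Set (lsuc (c ⊔ ℓ))
  DecidesPCE O = ∀ {n k} (C₁ C₂ : Code n k) (G₁ G₂ : Matrix k n) →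
    Generates G₁ C₁ → Generates G₂ C₂ →
    O (encodeInstance G₁ G₂) ≡ true ⇔ PermutationallyEquivalent C₁ C₂

  EncodesCodePair : (m k : ℕ) → 𝔻 → Set (lsuc (c ⊔ ℓ))
  EncodesCodePair m k w =
    Σ (Code m k) λ C₁ → Σ (Code m k) λ C₂ →
    Σ (Matrix k m) λ G₁ → Σ (Matrix k m) λ G₂ →
    Generates G₁ C₁ × Generates G₂ C₂ × w ≡ encodeInstance G₁ G₂

{-# OPTIONS --safe #-}
module Submission where

-- To find the image of a column g of G, add e copies of it to G and e copies of a candidate
-- column f to F.  If no column other than g occurs more than e times so far, an equivalence
-- of the enlarged codes must send g to f; cancelling the copies, it is an equivalence of the codes
-- before the enlargement.  So if the copies are kept, then every equivalence found later still
-- sends g to f, and the columns of G can be treated one after the other.  A column equal to an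
-- earlier one is the exception: its copies would pile up on those of the earlier one, so they are
-- discarded, and any unused f that the oracle accepts is a correct image.  Such a column
-- is recognised by the oracle accepting some f that is already in use.  With n (i + 1) - 1 copies
-- in stage i = 0, …, n - 1, the length is at most n (1 + … + n).

open import Defs
import Algebra.Properties.Semiring.Sum as Sum
open import Data.Bool.Base using (Bool; true; false)
open import Data.Fin.Base using (Fin; zero; suc; cast; punchIn; toℕ)
open import Data.Fin.Patterns
open import Data.Fin.Permutation as Perm using (Permutation′; _⟨$⟩ʳ_; _⟨$⟩ˡ_)
open import Data.Fin.Properties using (cast-involutive)
open import Data.List.Base as List
  using (List; []; _∷_; _++_; _ʳ++_; map; length; lookup; replicate; tabulate; allFin; filter)
open import Data.List.Membership.Propositional using () renaming (_∈_ to _∈ˡ_)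
open import Data.List.Membership.Propositional.Properties using (∈-allFin; ∈-tabulate⁻; ∈-++⁺ʳ)
open import Data.List.Properties
open import Data.List.Relation.Binary.Pointwise as Pointwise using (Pointwise; []; _∷_)
import Data.List.Relation.Binary.Permutation.Propositional as Propositional
import Data.List.Relation.Binary.Permutation.Propositional.Properties as Propositionalₚ
import Data.List.Relation.Binary.Permutation.Setoid as SetoidPermutation
import Data.List.Relation.Binary.Permutation.Setoid.Properties as SetoidPermutationₚ
open import Data.List.Relation.Unary.All as All using (All; []; _∷_)
import Data.List.Relation.Unary.All.Properties as Allₚ
open import Data.List.Relation.Unary.Any as Any using (Any; here; there)
import Data.List.Relation.Unary.Any.Properties as Anyₚ
open import Data.Nat.Base
  using (ℕ; zero; suc; pred; _+_; _*_; _^_; _/_; _≤_; _<_; z≤n; s≤s; NonZero; >-nonZero)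
open import Data.Nat.DivMod using (m*n/n≡m)
open import Data.Nat.Properties as ℕ using (≤-refl; ≤-trans; ≤-reflexive)
open import Data.Nat.Tactic.RingSolver using (solve-∀)
open import Data.Product.Base using (Σ; ∃; ∃₂; _×_; _,_; proj₁; proj₂)
open import Data.Sum.Base using (_⊎_; inj₁; inj₂)
open import Data.Vec.Base as Vec using ([]; _∷_; _[_]≔_)
import Data.Vec.Functional.Relation.Binary.Equality.Setoid as VectorEquality
import Data.Vec.Functional.Relation.Binary.Pointwise.Properties as VectorPointwise
open import Function.Base using (_∘_; id)
open import Function.Bundles using (Equivalence; _⇔_; mk⇔)
open import Level using (Level; _⊔_) renaming (suc to lsuc)
open import Relation.Binary.Bundles using (Setoid)
open import Relation.Binary.PropositionalEquality as ≡ using (_≡_; refl)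
import Relation.Binary.Reasoning.Setoid as SetoidReasoning
open import Relation.Nullary.Decidable using (Dec; yes; no)
open import Relation.Nullary.Negation using (¬_; contradiction)
open import Relation.Unary using (_∈_; _≐_)

-- Row spans and linear maps on columns

module Linear {c ℓ : Level} {q : ℕ} (𝔽 : FiniteField c ℓ q) where

  open FiniteField 𝔽 hiding (zero; refl)
  open FiniteField 𝔽 using () renaming (refl to ≈-refl)
  open Codes 𝔽
  open Sum semiring
  open VectorEquality setoidᶠ
  open SetoidReasoning setoidᶠ

  columns : ∀ {k n} → Matrix k n → Fin n → Word k
  columns G j i = G i j

  infix 8 _·_ _▹_

  _·_ : ∀ {k} → Word k → Word k → Carrier
  a · x = sum λ i → a i *ᶠ x i

  _▹_ : ∀ {k} → Matrix k k → Word k → Word k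
  (T ▹ x) i = T i · x

  ·-cong : ∀ {k} {a b x y : Word k} → a ≋ b → x ≋ y → a · x ≈ b · y
  ·-cong a≋b x≋y = sum-cong-≋ λ i → *-cong (a≋b i) (x≋y i)

  ·-congˡ : ∀ {k} (a : Word k) {x y : Word k} → x ≋ y → a · x ≈ a · y
  ·-congˡ a x≋y = ·-cong {a = a} (λ _ → ≈-refl) x≋y

  ▹-cong : ∀ {k} (T : Matrix k k) {x y : Word k} → x ≋ y → T ▹ x ≋ T ▹ y
  ▹-cong T x≋y i = ·-congˡ (T i) x≋y

  -- Interchange of the two sums. It moves a linear map from the columns to the coefficients of a
  -- combination of rows.
  ·-▹ : ∀ {k} (a : Word k) (T : Matrix k k) (x : Word k) →
        a · (T ▹ x) ≈ combination a T · x
  ·-▹ a T x = begin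
    sum (λ i → a i *ᶠ sum (λ s → T i s *ᶠ x s))
      ≈⟨ sum-cong-≋ (λ i → *-distribˡ-sum (a i) (λ s → T i s *ᶠ x s)) ⟩
    sum (λ i → sum (λ s → a i *ᶠ (T i s *ᶠ x s)))
      ≈⟨ ∑-comm (λ i s → a i *ᶠ (T i s *ᶠ x s)) ⟩
    sum (λ s → sum (λ i → a i *ᶠ (T i s *ᶠ x s)))
      ≈⟨ sum-cong-≋ (λ s → sum-cong-≋ (λ i → *-assoc (a i) (T i s) (x s))) ⟨
    sum (λ s → sum (λ i → (a i *ᶠ T i s) *ᶠ x s))
      ≈⟨ sum-cong-≋ (λ s → *-distribʳ-sum (x s) (λ i → a i *ᶠ T i s)) ⟨
    sum (λ s → sum (λ i → a i *ᶠ T i s) *ᶠ x s) ∎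

  unit : ∀ {k} → Fin k → Word k
  unit zero    zero    = 1#
  unit zero    (suc _) = 0#
  unit (suc i) zero    = 0#
  unit (suc i) (suc j) = unit i j

  unit-· : ∀ {k} (i : Fin k) (x : Word k) → unit i · x ≈ x i
  unit-· {suc k} zero x = begin
    1# *ᶠ x zero +ᶠ sum (λ i → 0# *ᶠ x (suc i))
      ≈⟨ +-cong (*-identityˡ _) (sum-cong-≋ λ i → zeroˡ (x (suc i))) ⟩
    x zero +ᶠ sum {k} (λ i → 0#)
      ≈⟨ +-congˡ (sum-replicate-zero k) ⟩
    x zero +ᶠ 0#
      ≈⟨ +-identityʳ _ ⟩
    x zero ∎
  unit-· (suc i) x = begin
    0# *ᶠ x zero +ᶠ unit i · (x ∘ suc) ≈⟨ +-cong (zeroˡ _) (unit-· i (x ∘ suc)) ⟩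
    0# +ᶠ x (suc i)                    ≈⟨ +-identityˡ _ ⟩
    x (suc i)                          ∎

  row∈rowSpan : ∀ {k n} (G : Matrix k n) i → G i ∈ rowSpan G
  row∈rowSpan G i = unit i , λ j → sym (unit-· i (columns G j))

  image-mono : ∀ {n} (π : Permutation′ n) {C D : Subset n} →
               (∀ {x} → x ∈ C → x ∈ D) → ∀ {x} → x ∈ image π C → x ∈ image π D
  image-mono π C⊆D (x , x∈C , eq) = x , C⊆D x∈C , eq

  image-cong : ∀ {n} (π : Permutation′ n) {C C′ D D′ : Subset n} →
               C ≐ C′ → D ≐ D′ → image π C ≐ D → image π C′ ≐ D′
  image-cong π {C} {C′} (C⊆C′ , C′⊆C) (D⊆D′ , D′⊆D) (⊆D , D⊆) =
    (λ y∈ → D⊆D′ (⊆D (image-mono π {C′} {C} C′⊆C y∈))) ,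
    (λ y∈ → image-mono π {C} {C′} C⊆C′ (D⊆ (D′⊆D y∈)))

  ≐-sym : ∀ {n} {C D : Subset n} → C ≐ D → D ≐ C
  ≐-sym (C⊆D , D⊆C) = D⊆C , C⊆D

  -- A permutation maps one row span onto the other iff it matches the
  -- columns up to a linear map that is invertible on the columns in
  -- question.

  record Matches {k n} (T T′ : Matrix k k) (G F : Matrix k n)
                 (π : Permutation′ n) : Set ℓ where
    field
      forth : ∀ j → columns G j ≋ T ▹ columns F (π ⟨$⟩ʳ j)
      back  : ∀ j → T′ ▹ (T ▹ columns F j) ≋ columns F j

  -- A combination of rows of `G` becomes one of rows of `F` by multiplying its coefficients with
  -- `T`. In the other direction they are multiplied with `T′`: as `T′` undoes `T` on the columns of
  -- `F`, no entry changes.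
  matches⇒image : ∀ {k n} {T T′ : Matrix k k} {G F : Matrix k n} {π} →
                  Matches T T′ G F π → image π (rowSpan G) ≐ rowSpan F
  matches⇒image {T = T} {T′} {G} {F} {π} match = ⊆F , F⊆
    where
    open Matches match
    forth′ : ∀ j → columns G (π ⟨$⟩ˡ j) ≋ T ▹ columns F j
    forth′ j = ≡.subst (λ l → columns G (π ⟨$⟩ˡ j) ≋ T ▹ columns F l)
                       (Perm.inverseʳ π) (forth (π ⟨$⟩ˡ j))
    ⊆F : ∀ {y} → y ∈ image π (rowSpan G) → y ∈ rowSpan F
    ⊆F {y} (x , (a , x≋) , y≋) = combination a T , λ j → begin
      y j                                ≈⟨ y≋ j ⟩
      x (π ⟨$⟩ˡ j)                       ≈⟨ x≋ (π ⟨$⟩ˡ j) ⟩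
      a · columns G (π ⟨$⟩ˡ j)           ≈⟨ ·-congˡ a (forth′ j) ⟩
      a · (T ▹ columns F j)              ≈⟨ ·-▹ a T (columns F j) ⟩
      combination a T · columns F j      ∎
    F⊆ : ∀ {y} → y ∈ rowSpan F → y ∈ image π (rowSpan G)
    F⊆ {y} (b , y≋) =
      combination (combination b T′) G , (combination b T′ , λ _ → ≈-refl) , λ j → begin
      y j                                          ≈⟨ y≋ j ⟩
      b · columns F j                              ≈⟨ ·-congˡ b (back j) ⟨
      b · (T′ ▹ (T ▹ columns F j))                 ≈⟨ ·-▹ b T′ (T ▹ columns F j) ⟩
      combination b T′ · (T ▹ columns F j)         ≈⟨ ·-congˡ (combination b T′) (forth′ j) ⟨
      combination b T′ · columns G (π ⟨$⟩ˡ j)      ∎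

  -- The rows of `T` are the coefficients that express the permuted rows of `G` by rows of `F`;
  -- those of `T′` express the rows of `F` by permuted rows of `G`. Read column by column, the first
  -- is `forth`; inserted into the second it gives `back`.
  image⇒matches : ∀ {k n} {G F : Matrix k n} {π} → image π (rowSpan G) ≐ rowSpan F →
                  ∃ λ T → ∃ λ T′ → Matches T T′ G F π
  image⇒matches {k} {n} {G} {F} {π} (⊆F , F⊆) = T , T′ , record
    { forth = λ j → ≡.subst (λ l → columns G l ≋ T ▹ columns F (π ⟨$⟩ʳ j))
                            (Perm.inverseˡ π) (forth′ (π ⟨$⟩ʳ j))
    ; back  = λ j i → begin
        T′ i · (T ▹ columns F j)          ≈⟨ ·-congˡ (T′ i) (forth′ j) ⟨
        T′ i · columns G (π ⟨$⟩ˡ j)       ≈⟨ proj₂ (proj₁ (proj₂ (preimage i))) (π ⟨$⟩ˡ j) ⟨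
        proj₁ (preimage i) (π ⟨$⟩ˡ j)     ≈⟨ proj₂ (proj₂ (preimage i)) j ⟨
        F i j                             ∎
    }
    where
    permuted : ∀ i → permute π (G i) ∈ rowSpan F
    permuted i = ⊆F (G i , row∈rowSpan G i , λ _ → ≈-refl)
    preimage : ∀ i → F i ∈ image π (rowSpan G)
    preimage i = F⊆ (row∈rowSpan F i)
    T T′ : Matrix k k
    T  i = proj₁ (permuted i)
    T′ i = proj₁ (proj₁ (proj₂ (preimage i)))
    forth′ : ∀ j → columns G (π ⟨$⟩ˡ j) ≋ T ▹ columns F j
    forth′ j i = proj₂ (permuted i) j

  -- Repeating columns of a code

  select : ∀ {k m n} → (Fin m → Fin n) → Matrix k n → Matrix k m
  select φ G i j = G i (φ j)

  module _ {k m n : ℕ} (φ : Fin m → Fin n) (surjective : ∀ j → ∃ λ i → φ i ≡ j) where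

    restrict : ∀ {x y : Word n} → (x ∘ φ) ≋ (y ∘ φ) → x ≋ y
    restrict {x} {y} eq j with surjective j
    ... | i , refl = eq i

    pullback : Subset n → Subset m
    pullback C x = ∃ λ y → y ∈ C × x ≋ (y ∘ φ)

    pullback-rowSpan : ∀ {C} {G : Matrix k n} → C ≐ rowSpan G →
                       pullback C ≐ rowSpan (select φ G)
    pullback-rowSpan (C⊆ , ⊆C) =
      (λ { (y , y∈ , x≋) → let a , y≋ = C⊆ y∈ in a , λ j → trans (x≋ j) (y≋ (φ j)) }) ,
      (λ { (a , x≋) → _ , ⊆C (a , λ _ → ≈-refl) , x≋ })

    -- `φ` may repeat coordinates but, being onto, drops none: a word is determined by its pullback.
    -- Hence the basis stays independent and the dimension stays `k`.
    expand : Code n k → Code m k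
    expand C = record
      { words      = pullback (words C)
      ; isSubspace = record
        { resp     = λ { x≋x′ (y , y∈ , x≋) → y , y∈ , λ j → trans (sym (x≋x′ j)) (x≋ j) }
        ; 0-closed = 0ʷ , 0-closed , λ _ → ≈-refl
        ; +-closed = λ { (y , y∈ , x≋) (y′ , y′∈ , x′≋) →
                         (y +ʷ y′) , +-closed y∈ y′∈ , λ j → +-cong (x≋ j) (x′≋ j) }
        ; *-closed = λ { a (y , y∈ , x≋) →
                         (a *ʷ y) , *-closed a y∈ , λ j → *-congˡ (x≋ j) }
        }
      ; basis      = select φ (Code.basis C)
      ; isBasis    = record
        { independent = λ a eq → independent a (restrict eq)
        ; spanning    = pullback-rowSpan spanning
        }
      }
      where
      open IsSubspace (Code.isSubspace C)
      open IsBasis (Code.isBasis C)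

-- Rearrangements of tabulated lists and permutations of indices

module TabulatePermutation {a ℓ : Level} (S : Setoid a ℓ) where

  open Setoid S using (_≈_)
    renaming (Carrier to A; sym to ≈-sym; trans to ≈-trans; reflexive to ≈-reflexive)
  open SetoidPermutation S
  open SetoidPermutationₚ S using (onIndices-lookup; drop-∷)

  ∷-cancel : ∀ {x y xs ys} → x ≈ y → x ∷ xs ↭ y ∷ ys → xs ↭ ys
  ∷-cancel x≈y p = drop-∷ (↭-trans (prep (≈-sym x≈y) ↭-refl) p)

  tabulate-punchIn : ∀ {m} (g : Fin (suc m) → A) l →
                     g l ∷ tabulate (g ∘ punchIn l) ↭ tabulate g
  tabulate-punchIn         g zero    = ↭-refl
  tabulate-punchIn {suc m} g (suc l) = ↭-trans
    (↭-swap (g (suc l)) (g zero) ↭-refl)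
    (↭-prep (g zero) (tabulate-punchIn (g ∘ suc) l))

  -- By induction, taking out the first entry on the left and its partner, at position
  -- `π ⟨$⟩ʳ zero`, on the right.
  tabulate-↭ : ∀ {m} {f g : Fin m → A} (π : Permutation′ m) →
               (∀ j → f j ≈ g (π ⟨$⟩ʳ j)) → tabulate f ↭ tabulate g
  tabulate-↭ {zero}          π eq = ↭-refl
  tabulate-↭ {suc m} {f} {g} π eq = ↭-trans
    (prep (eq zero) (tabulate-↭ (Perm.remove zero π) λ j →
      ≈-trans (eq (suc j)) (≈-reflexive (≡.cong g (Perm.punchIn-permute π zero j)))))
    (tabulate-punchIn g (π ⟨$⟩ʳ zero))

  lookup-tabulate′ : ∀ {m} (f : Fin m → A) i →
                     lookup (tabulate f) i ≡ f (cast (length-tabulate f) i)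
  lookup-tabulate′ f i = ≡.trans
    (≡.cong (lookup (tabulate f))
      (≡.sym (cast-involutive (≡.sym (length-tabulate f)) (length-tabulate f) i)))
    (lookup-tabulate f (cast (length-tabulate f) i))

  -- A rearrangement induces a bijection of list positions; the casts identify these positions with
  -- `Fin m`.
  ↭-tabulate : ∀ {m} {f g : Fin m → A} → tabulate f ↭ tabulate g →
               ∃ λ (π : Permutation′ m) → ∀ j → f j ≈ g (π ⟨$⟩ʳ j)
  ↭-tabulate {f = f} {g} p =
    Perm.cast-id (≡.sym (length-tabulate f)) Perm.∘ₚ
      (onIndices p Perm.∘ₚ Perm.cast-id (length-tabulate g)) ,
    λ j → ≈-trans (≈-reflexive (≡.sym (lookup-tabulate f j)))
            (≈-trans (onIndices-lookup p _) (≈-reflexive (lookup-tabulate′ g _)))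

-- Both relations are read at the same position, the one where `R` holds. This allows two linear
-- maps to be compared on one matched pair of columns.
Pointwise-pick : ∀ {a p q r s} {A : Set a} {B : Set p} {P : A → B → Set q} {Q : A → B → Set r}
                 {R : B → Set s} {xs ys} → Pointwise P xs ys → Pointwise Q xs ys → Any R ys →
                 ∃₂ λ x y → P x y × Q x y × R y
Pointwise-pick (p ∷ _)  (q ∷ _)  (here r)   = _ , _ , p , q , r
Pointwise-pick (_ ∷ ps) (_ ∷ qs) (there rs) = Pointwise-pick ps qs rs

Pointwise-Anyˡ : ∀ {a p q r} {A : Set a} {B : Set p} {P : A → B → Set q} {R : A → Set r}
                 {xs ys} → Pointwise P xs ys → Any R xs → Any (λ y → ∃ λ x → P x y × R x) ys
Pointwise-Anyˡ (p ∷ _)  (here r)   = here (_ , p , r)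
Pointwise-Anyˡ (_ ∷ ps) (there rs) = there (Pointwise-Anyˡ ps rs)

-- Matching lists of columns with repetitions

module Reduction {c ℓ : Level} {q : ℕ} (𝔽 : FiniteField c ℓ q) {n k : ℕ}
  (G F : Codes.Matrix 𝔽 k n) where

  open Codes 𝔽
  open FiniteField 𝔽 using (_≟_; setoidᶠ)
  open Linear 𝔽
  open VectorEquality setoidᶠ
  open Setoid (≋-setoid k) using ()
    renaming (refl to ≈-refl; sym to ≈-sym; trans to ≈-trans; reflexive to ≈-reflexive)
  open SetoidPermutation (≋-setoid k)
  open SetoidPermutationₚ (≋-setoid k) using (filter⁺; xs↭ys⇒|xs|≡|ys|; ∈-resp-↭; ¬x∷xs↭[])
  open TabulatePermutation (≋-setoid k)
  open Propositional using ()
    renaming (_↭_ to _↭ₚ_; ↭-sym to ↭ₚ-sym; ↭-trans to ↭ₚ-trans; ↭-reflexive to ↭ₚ-reflexive)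

  _≋?_ : (x y : Word k) → Dec (x ≋ y)
  _≋?_ = VectorPointwise.decidable _≟_

  g : Fin n → Word k
  g = columns G

  f : Fin n → Word k
  f = columns F

  lift : ∀ (h : Fin n → Word k) {xs ys} → xs ↭ₚ ys → map h xs ↭ map h ys
  lift h p = Propositional.↭⇒↭ₛ′ (Setoid.isEquivalence (≋-setoid k)) (Propositionalₚ.map⁺ h p)

  -- The counterpart of `Matches` for lists of column indices. The permutation is left implicit in a
  -- rearrangement up to `≋`, so that equal columns can be cancelled and counted.
  record Match (T T′ : Matrix k k) (as bs : List (Fin n)) : Set (c ⊔ ℓ) where
    field
      perm : map g as ↭ map (λ l → T ▹ f l) bs
      back : All (λ l → T′ ▹ (T ▹ f l) ≋ f l) bs

  open Match

  Matching : (as bs : List (Fin n)) → Set (c ⊔ ℓ)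
  Matching as bs = ∃₂ λ T T′ → Match T T′ as bs

  -- Ensures that the enlarged codes still have dimension `k`, and that `back` applies to every
  -- column of `F`.
  Covers : List (Fin n) → Set
  Covers as = ∀ j → j ∈ˡ as

  -- Since `encodeMatrix` goes column by column, adding a copy of a column is a single `cons`, and
  -- the program never has to look inside a column.
  columnList : Matrix k n → List (Fin n) → 𝔻
  columnList M as = encodeList (map (λ j → encodeVector encodeElement (columns M j)) as)

  pairList : (as bs : List (Fin n)) → 𝔻
  pairList as bs = cons (columnList G as) (columnList F bs)

  columnList-select : ∀ {m} (M : Matrix k n) (φ : Fin m → Fin n) →
                      columnList M (tabulate φ) ≡ encodeMatrix (select φ M)
  columnList-select M φ =
    ≡.cong encodeList (map-tabulate φ (λ j → encodeVector encodeElement (columns M j)))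

  covers-surjective : ∀ {m} {φ : Fin m → Fin n} → Covers (tabulate φ) → ∀ j → ∃ λ i → φ i ≡ j
  covers-surjective covers j with ∈-tabulate⁻ (covers j)
  ... | i , eq = i , ≡.sym eq

  match⇒matches : ∀ {m T T′} {φ ψ : Fin m → Fin n} → Match T T′ (tabulate φ) (tabulate ψ) →
                  ∃ (Matches T T′ (select φ G) (select ψ F))
  match⇒matches {T = T} {φ = φ} {ψ} match =
    proj₁ forth , record { forth = proj₂ forth ; back = Allₚ.tabulate⁻ (back match) }
    where
    forth = ↭-tabulate {f = g ∘ φ} {λ i → T ▹ f (ψ i)}
      (≡.subst₂ _↭_ (map-tabulate φ g) (map-tabulate ψ (λ l → T ▹ f l)) (perm match))

  matches⇒match : ∀ {m T T′ π} {φ ψ : Fin m → Fin n} →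
                  Matches T T′ (select φ G) (select ψ F) π → Match T T′ (tabulate φ) (tabulate ψ)
  matches⇒match {T = T} {π = π} {φ} {ψ} matches = record
    { perm = ≡.subst₂ _↭_ (≡.sym (map-tabulate φ g)) (≡.sym (map-tabulate ψ (λ l → T ▹ f l)))
               (tabulate-↭ π (Matches.forth matches))
    ; back = Allₚ.tabulate⁺ (Matches.back matches)
    }

  tabulated : ∀ {m} {bs : List (Fin n)} → m ≡ length bs → ∃ λ (ψ : Fin m → Fin n) → bs ≡ tabulate ψ
  tabulated {bs = bs} refl = lookup bs , ≡.sym (tabulate-lookup bs)

  module _ {C₁ C₂ : Code n k} (generatesG : Generates G C₁) (generatesF : Generates F C₂) where

    isQuery : ∀ {as bs} → length as ≡ length bs → Covers as → Covers bs →
              EncodesCodePair (length as) k (pairList as bs)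
    isQuery {as} {bs} len coversˡ coversʳ with tabulated {bs = as} refl | tabulated {bs = bs} len
    ... | φ , eqˡ | ψ , refl =
      expand φ surjφ C₁ , expand ψ surjψ C₂ , select φ G , select ψ F ,
      pullback-rowSpan φ surjφ generatesG , pullback-rowSpan ψ surjψ generatesF ,
      ≡.cong₂ cons (≡.trans (≡.cong (columnList G) eqˡ) (columnList-select G φ))
                   (columnList-select F ψ)
      where
      surjφ = covers-surjective (≡.subst Covers eqˡ coversˡ)
      surjψ = covers-surjective coversʳ

    -- The lists select columns of `G` and `F` and so present a pair of expanded codes. An
    -- equivalence of these translates into a pair of linear maps by `image⇒matches`, and back by
    -- `matches⇒image`.
    decides : ∀ {O} → DecidesPCE O → ∀ {as bs} → length as ≡ length bs → Covers as → Covers bs →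
              O (pairList as bs) ≡ true ⇔ Matching as bs
    decides {O} oracle {as} {bs} len coversˡ coversʳ with tabulated {bs = as} refl | tabulated {bs = bs} len
    ... | φ , eqˡ | ψ , refl = ≡.subst
      (λ as → O (pairList as (tabulate ψ)) ≡ true ⇔ Matching as (tabulate ψ)) (≡.sym eqˡ)
      (≡.subst (λ w → O w ≡ true ⇔ Matching (tabulate φ) (tabulate ψ))
        (≡.sym (≡.cong₂ cons (columnList-select G φ) (columnList-select F ψ)))
        (mk⇔ to from))
      where
      surjφ = covers-surjective (≡.subst Covers eqˡ coversˡ)
      surjψ = covers-surjective coversʳ
      D₁ = expand φ surjφ C₁
      D₂ = expand ψ surjψ C₂
      genφ : Generates (select φ G) D₁
      genφ = pullback-rowSpan φ surjφ generatesG
      genψ : Generates (select ψ F) D₂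
      genψ = pullback-rowSpan ψ surjψ generatesF
      answer : O (encodeInstance (select φ G) (select ψ F)) ≡ true ⇔ PermutationallyEquivalent D₁ D₂
      answer = oracle D₁ D₂ (select φ G) (select ψ F) genφ genψ
      to : O (encodeInstance (select φ G) (select ψ F)) ≡ true → Matching (tabulate φ) (tabulate ψ)
      to accepted with Equivalence.to answer accepted
      ... | π , maps with image⇒matches {G = select φ G} {select ψ F} {π} (image-cong π genφ genψ maps)
      ... | T , T′ , matches = T , T′ , matches⇒match matches
      from : Matching (tabulate φ) (tabulate ψ) → O (encodeInstance (select φ G) (select ψ F)) ≡ true
      from (T , T′ , match) with match⇒matches match
      ... | π , matches = Equivalence.from answer
        (π , image-cong π (≐-sym genφ) (≐-sym genψ) (matches⇒image matches))

  -- Multiplicities of columns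

  occ : Word k → List (Word k) → ℕ
  occ v xs = length (filter (v ≋?_) xs)

  occ-↭ : ∀ v {xs ys} → xs ↭ ys → occ v xs ≡ occ v ys
  occ-↭ v p = xs↭ys⇒|xs|≡|ys| (filter⁺ (v ≋?_) (λ x≋y v≋x → ≈-trans v≋x x≋y) p)

  pin : ℕ → Fin n → List (Fin n) → List (Fin n)
  pin e r as = replicate e r ++ as

  -- The flag tells whether the column of `G` repeats one treated before.
  pinUnless : Bool → ℕ → Fin n → List (Fin n) → List (Fin n)
  pinUnless true  e r as = as
  pinUnless false e r as = pin e r as

  occ-pin-≋ : ∀ v e r as {h : Fin n → Word k} → v ≋ h r → occ v (map h (pin e r as)) ≡ e + occ v (map h as)
  occ-pin-≋ v zero    r as eq = refl
  occ-pin-≋ v (suc e) r as eq = ≡.trans (≡.cong length (filter-accept (v ≋?_) eq))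
                                        (≡.cong suc (occ-pin-≋ v e r as eq))

  occ-pin-≉ : ∀ v e r as {h : Fin n → Word k} → ¬ v ≋ h r → occ v (map h (pin e r as)) ≡ occ v (map h as)
  occ-pin-≉ v zero    r as ne = refl
  occ-pin-≉ v (suc e) r as ne = ≡.trans (≡.cong length (filter-reject (v ≋?_) ne))
                                        (occ-pin-≉ v e r as ne)

  unpin-perm : ∀ {T r l} e {as bs} → g r ≋ T ▹ f l →
               map g (pin e r as) ↭ map (λ l → T ▹ f l) (pin e l bs) →
               map g as ↭ map (λ l → T ▹ f l) bs
  unpin-perm zero    eq p = p
  unpin-perm (suc e) eq p = unpin-perm e eq (∷-cancel eq p)

  pin-perm : ∀ {T r l} e {as bs} → g r ≋ T ▹ f l →
             map g as ↭ map (λ l → T ▹ f l) bs →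
             map g (pin e r as) ↭ map (λ l → T ▹ f l) (pin e l bs)
  pin-perm zero    eq p = p
  pin-perm (suc e) eq p = prep eq (pin-perm e eq p)

  occG : Word k → ℕ
  occG v = occ v (map g (allFin n))

  -- The number of columns added by r further stages if none of their columns is a repetition.

  pot : ℕ → ℕ → ℕ
  pot zero    e = 0
  pot (suc r) e = e + pot r (n + e)

  -- g_r for r in done has been matched with the corresponding column of F in W; rs and U are the
  -- remaining columns.  In stage i, e is n (i + 1) - 1.

  record Invariant (rs done GX FX U W : List (Fin n)) (e : ℕ) : Set (c ⊔ ℓ) where
    field
      sound    : ∀ {T T′} → Match T T′ GX FX →
                 Pointwise (λ r w → g r ≋ T ▹ f w) done W ×
                 map g rs ↭ map (λ l → T ▹ f l) U
      current  : Matching GX FX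
      -- Subtraction-free form of `occ v ≤ e + 1 - (n - occG v)`. If some column of `G` differs from
      -- `v`, then `occG v < n`, and so `v` occurs at most `e` times.
      bounded  : ∀ v → occ v (map g GX) + n ≤ occG v + suc e
      fresh    : ∀ v → All (λ r → ¬ v ≋ g r) done → occ v (map g GX) ≤ occG v
      -- The columns are treated from the last to the first, so that `done` ends up in natural
      -- order.
      order    : rs ʳ++ done ≡ allFin n
      partition : U ++ W ↭ₚ allFin n
      coversˡ  : Covers GX
      coversʳ  : Covers FX
      balanced : length GX ≡ length FX
      room     : length GX + pot (length rs) e ≤ n ^ 2 * (n + 1) / 2
      -- A stage raises `e` by `n` and shortens `rs` by one, so the left side is constant. While a
      -- column is left it gives `e ≤ n * n`, which bounds the time of a query.
      small    : e + n * length rs ≤ n + n * n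

  -- A single stage

  module _ {r : Fin n} {rs done GX FX U W : List (Fin n)} {e : ℕ}
    (inv : Invariant (r ∷ rs) done GX FX U W e) where

    open Invariant inv

    Query : Fin n → Set (c ⊔ ℓ)
    Query l = Matching (pin e r GX) (pin e l FX)

    covers-pin : ∀ {as} l → Covers as → Covers (pin e l as)
    covers-pin l covers j = ∈-++⁺ʳ (replicate e l) (covers j)

    balanced-pin : ∀ l → length (pin e r GX) ≡ length (pin e l FX)
    balanced-pin l = begin
      length (replicate e r ++ GX)       ≡⟨ length-++ (replicate e r) ⟩
      length (replicate e r) + length GX
        ≡⟨ ≡.cong₂ _+_ (≡.trans (length-replicate e) (≡.sym (length-replicate e))) balanced ⟩
      length (replicate e l) + length FX ≡⟨ length-++ (replicate e l) ⟨
      length (replicate e l ++ FX)       ∎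
      where open ≡.≡-Reasoning

    length-pin : ∀ (l : Fin n) as → length (pin e l as) ≡ e + length as
    length-pin l as = ≡.trans (length-++ (replicate e l)) (≡.cong (_+ length as) (length-replicate e))

    room-pin : length (pin e r GX) + pot (length rs) (n + e) ≤ n ^ 2 * (n + 1) / 2
    room-pin = ≤-trans (≤-reflexive (≡.trans
      (≡.cong (_+ pot (length rs) (n + e)) (length-pin r GX)) (lemma e (length GX) _))) room
      where
      lemma : ∀ e g p → (e + g) + p ≡ g + (e + p)
      lemma = solve-∀

    back-of : ∀ {T T′} → Match T T′ GX FX → ∀ l → T′ ▹ (T ▹ f l) ≋ f l
    back-of match l = All.lookup (back match) (coversʳ l)

    -- The column T f_l occurs at least e + 1 times on the right; if it were not g_r, it would
    -- occur on the left at most e times.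
    unpin : ∀ {T T′ l} → Match T T′ (pin e r GX) (pin e l FX) →
            g r ≋ T ▹ f l × Match T T′ GX FX
    unpin {T} {T′} {l} match with (T ▹ f l) ≋? g r
    ... | yes eq = ≈-sym eq , record
      { perm = unpin-perm e (≈-sym eq) (perm match)
      ; back = Allₚ.++⁻ʳ (replicate e l) (back match)
      }
    ... | no ne = contradiction (≤-trans few many) (ℕ.<⇒≱ (ℕ.+-monoˡ-< (suc e) missing))
      where
      v = T ▹ f l
      missing : occG v < n
      missing = ≡.subst (occG v <_) (≡.trans (length-map g (allFin n)) (length-tabulate id))
        (filter-notAll (v ≋?_) (map g (allFin n))
          (Anyₚ.map⁺ (Any.map (λ { refl → ne }) (∈-allFin r))))
      present : 0 < occ v (map (λ l → T ▹ f l) FX)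
      present = filter-some (v ≋?_) (Anyₚ.map⁺ (Any.map (λ { refl → ≈-refl }) (coversʳ l)))
      count : occ v (map g GX) ≡ e + occ v (map (λ l → T ▹ f l) FX)
      count = ≡.trans (≡.sym (occ-pin-≉ v e r GX ne))
        (≡.trans (occ-↭ v (perm match)) (occ-pin-≋ v e l FX ≈-refl))
      few : n + suc e ≤ occ v (map g GX) + n
      few = ≤-trans (≤-reflexive (ℕ.+-comm n (suc e)))
        (ℕ.+-monoˡ-≤ n (≤-trans (≤-reflexive (ℕ.+-comm 1 e))
          (≤-trans (ℕ.+-monoʳ-≤ e present) (≤-reflexive (≡.sym count)))))
      many : occ v (map g GX) + n ≤ occG v + suc e
      many = bounded v

    -- The converse of `unpin`: together they show that `Query l` holds exactly when some match of
    -- the current lists takes `f l` to `g r`.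
    pinned : ∀ {T T′ l} → g r ≋ T ▹ f l → Match T T′ GX FX → Match T T′ (pin e r GX) (pin e l FX)
    pinned {l = l} eq match = record
      { perm = pin-perm e eq (perm match)
      ; back = Allₚ.++⁺ (Allₚ.replicate⁺ e (back-of match l)) (back match)
      }

    -- For the match in `current`, `sound` rearranges the untreated columns of `G` into the images
    -- of those in `U`; the partner of `g r` is accepted by `pinned`.
    candidate : Any Query U
    candidate with current
    ... | T , T′ , match =
      Any.map (λ eq → T , T′ , pinned eq match)
        (Anyₚ.map⁻ (∈-resp-↭ (proj₂ (sound match)) (here ≈-refl)))

    Seen : List (Fin n) → Bool → Set (c ⊔ ℓ)
    Seen ws true  = Any Query ws
    Seen ws false = All (λ w → ¬ Query w) ws

    private
      remaining : ∀ {T l V} → g r ≋ T ▹ f l → l ∷ V ↭ₚ U → map g (r ∷ rs) ↭ map (λ l → T ▹ f l) U →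
                  map g rs ↭ map (λ l → T ▹ f l) V
      remaining {T} eq l∷V↭U p = ∷-cancel eq (↭-trans p
        (lift (λ l → T ▹ f l) (↭ₚ-sym l∷V↭U)))

      repartition : ∀ {l V} → l ∷ V ↭ₚ U → V ++ l ∷ W ↭ₚ allFin n
      repartition {l} {V} l∷V↭U = ↭ₚ-trans (Propositionalₚ.shift l V W)
        (↭ₚ-trans (Propositionalₚ.++⁺ʳ W l∷V↭U) partition)

      small′ : (n + e) + n * length rs ≤ n + n * n
      small′ = ≤-trans (≤-reflexive (lemma n e (length rs))) small
        where
        lemma : ∀ n e s → (n + e) + n * s ≡ e + n * suc s
        lemma = solve-∀

      -- By `sound`, all matches take the used column `f w` to the same treated column of `G`. If
      -- one match takes it to `g r`, then all do.
      transfer : ∀ {w T₁ T₁′} → w ∈ˡ W → g r ≋ T₁ ▹ f w → Match T₁ T₁′ GX FX →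
                 ∀ {T T′} → Match T T′ GX FX → g r ≋ T ▹ f w
      transfer w∈W eq match₁ match with Pointwise-pick (proj₁ (sound match₁)) (proj₁ (sound match)) w∈W
      ... | _ , _ , p₁ , p , refl = ≈-trans eq (≈-trans (≈-sym p₁) p)

      bound-pin : All (λ w → ¬ Query w) W → ∀ v → occ v (map g (pin e r GX)) + n ≤ occG v + suc (n + e)
      bound-pin unused v with v ≋? g r
      ... | no ne  = ≤-trans (≤-trans (≤-reflexive (≡.cong (_+ n) (occ-pin-≉ v e r GX ne))) (bounded v))
                       (ℕ.+-monoʳ-≤ (occG v) (s≤s (ℕ.m≤n+m e n)))
      ... | yes eq = ≤-trans (≤-reflexive (≡.cong (_+ n) (occ-pin-≋ v e r GX eq)))
                       (≤-trans (ℕ.+-monoˡ-≤ n (ℕ.+-monoʳ-≤ e (fresh v new)))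
                         (≤-trans (≤-reflexive (lemma e (occG v) n)) (ℕ.+-monoʳ-≤ (occG v) (ℕ.n≤1+n (n + e)))))
        where
        lemma : ∀ e o n → e + o + n ≡ o + (n + e)
        lemma = solve-∀
        -- If a treated column equalled `g r`, its partner in `W` would be an accepted query. So
        -- `g r` has received no copies yet, and `fresh` bounds its previous count by `occG v`.
        new : All (λ r′ → ¬ v ≋ g r′) done
        new with current
        ... | T , T′ , match = Allₚ.¬Any⇒All¬ done λ old →
          Allₚ.All¬⇒¬Any unused (Any.map
            (λ { (r′ , p , v≋r′) → T , T′ , pinned (≈-trans (≈-sym eq) (≈-trans v≋r′ p)) match })
            (Pointwise-Anyˡ (proj₁ (sound match)) old))

    -- The lists do not change, so `sound` has to be extended without new copies. An accepted `w` in
    -- `W` shows that every match takes `f w` to `g r`; as `f w` and `f l` are equal columns, every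
    -- match also takes `f l` to `g r`.
    step-old : ∀ {l V} → Any Query W → Query l → l ∷ V ↭ₚ U →
               Invariant rs (r ∷ done) GX FX V (l ∷ W) (n + e)
    step-old {l} {V} dup (T₀ , T₀′ , query) l∷V↭U = record
      { sound    = λ match → let eq = agree match ; done , rest = sound match in
                   eq ∷ done , remaining eq l∷V↭U rest
      ; current  = current
      ; bounded  = λ v → ≤-trans (bounded v) (ℕ.+-monoʳ-≤ (occG v) (s≤s (ℕ.m≤n+m e n)))
      ; fresh    = λ { v (_ ∷ new) → fresh v new }
      ; order    = order
      ; partition = repartition l∷V↭U
      ; coversˡ  = coversˡ
      ; coversʳ  = coversʳ
      ; balanced = balanced
      ; room     = ≤-trans (ℕ.+-monoʳ-≤ (length GX) (ℕ.m≤n+m _ e)) room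
      ; small    = small′
      }
      where
      agree : ∀ {T T′} → Match T T′ GX FX → g r ≋ T ▹ f l
      agree {T} match with unpin query | Any.satisfied (Any-∈ dup)
        where
        Any-∈ : ∀ {xs} → Any Query xs → Any (λ w → w ∈ˡ xs × Query w) xs
        Any-∈ (here q)   = here (here refl , q)
        Any-∈ (there qs) = there (Any.map (λ { (w∈ , q) → there w∈ , q }) (Any-∈ qs))
      ... | eq₀ , match₀ | w , w∈W , (_ , _ , queryw) with unpin queryw
      ... | eq₁ , match₁ = ≈-trans (transfer w∈W eq₁ match₁ match) (▹-cong T same)
        where
        -- `T₀`, from the accepted query for `l`, takes both columns to `g r`, and `T₀′` undoes it.
        same : f w ≋ f l
        same = ≈-trans (≈-sym (back-of match₀ w))
          (≈-trans (▹-cong T₀′ (≈-trans (≈-sym (transfer w∈W eq₁ match₁ match₀)) eq₀))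
            (back-of match₀ l))

    -- By `unpin`, a match of the enlarged lists is a match of the old ones that also takes `f l` to
    -- `g r`; this is the pair by which `sound` grows.
    step-new : ∀ {l V} → All (λ w → ¬ Query w) W → Query l → l ∷ V ↭ₚ U →
               Invariant rs (r ∷ done) (pin e r GX) (pin e l FX) V (l ∷ W) (n + e)
    step-new {l} {V} unused query l∷V↭U = record
      { sound    = λ match → let eq , match′ = unpin match ; done , rest = sound match′ in
                   eq ∷ done , remaining eq l∷V↭U rest
      ; current  = query
      ; bounded  = bound-pin unused
      ; fresh    = λ { v (ne ∷ new) → ≤-trans (≤-reflexive (occ-pin-≉ v e r GX ne)) (fresh v new) }
      ; order    = order
      ; partition = repartition l∷V↭U
      ; coversˡ  = covers-pin r coversˡ
      ; coversʳ  = covers-pin l coversʳ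
      ; balanced = balanced-pin l
      ; room     = room-pin
      ; small    = small′
      }

    step : ∀ b {l V} → Seen W b → Query l → l ∷ V ↭ₚ U →
           Invariant rs (r ∷ done) (pinUnless b e r GX) (pinUnless b e l FX)
             V (l ∷ W) (n + e)
    step true  = step-old
    step false = step-new

  -- The final permutation, the length bound and the initial state

  ↭-allFin : ∀ {W : List (Fin n)} → W ↭ₚ allFin n → ∃ λ (π : Permutation′ n) → W ≡ tabulate (π ⟨$⟩ʳ_)
  ↭-allFin {W} p =
    let h , W≡  = tabulated {bs = W} (≡.trans (≡.sym (length-tabulate id)) (≡.sym (Propositionalₚ.↭-length p)))
        π , h≗π = TabulatePermutation.↭-tabulate (≡.setoid (Fin n)) {f = h} {id}
                    (Propositional.↭⇒↭ₛ (≡.subst (_↭ₚ allFin n) W≡ p))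
    in π , ≡.trans W≡ (tabulate-cong h≗π)

  -- With no column of `G` left, `sound` forces `U` to be empty, so `W` is a permutation of all
  -- indices. The pairs that `sound` gives for the match in `current` are the `forth` equations.
  finish : ∀ {GX FX U W e} → Invariant [] (allFin n) GX FX U W e →
           ∃₂ λ T T′ → ∃ λ (π : Permutation′ n) → W ≡ tabulate (π ⟨$⟩ʳ_) × Matches T T′ G F π
  finish {U = _ ∷ _} inv =
    let _ , _ , match = current in contradiction (↭-sym (proj₂ (sound match))) ¬x∷xs↭[]
    where open Invariant inv
  finish {U = []} {W} inv =
    let T , T′ , match = current
        π , W≡         = ↭-allFin {W} partition
        done           = ≡.subst (Pointwise (λ r w → g r ≋ T ▹ f w) (allFin n)) W≡ (proj₁ (sound match))
    in T , T′ , π , W≡ , record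
      { forth = Pointwise.tabulate⁻ done
      ; back  = λ j → All.lookup (back match) (coversʳ j)
      }
    where open Invariant inv

  -- The closed form `pot r e = r e + n r (r - 1) / 2`, doubled and without subtraction.
  2*pot : ∀ r e → 2 * pot r e + r * n ≡ 2 * (r * e) + r * r * n
  2*pot zero    e = refl
  2*pot (suc r) e = begin
    2 * (e + pot r (n + e)) + suc r * n          ≡⟨ lemma₁ e (pot r (n + e)) r n ⟩
    2 * e + n + (2 * pot r (n + e) + r * n)      ≡⟨ ≡.cong (2 * e + n +_) (2*pot r (n + e)) ⟩
    2 * e + n + (2 * (r * (n + e)) + r * r * n)  ≡⟨ lemma₂ e r n ⟩
    2 * (suc r * e) + suc r * suc r * n          ∎
    where
    open ≡.≡-Reasoning
    lemma₁ : ∀ e p r n → 2 * (e + p) + suc r * n ≡ 2 * e + n + (2 * p + r * n)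
    lemma₁ = solve-∀
    lemma₂ : ∀ e r n → 2 * e + n + (2 * (r * (n + e)) + r * r * n) ≡ 2 * (suc r * e) + suc r * suc r * n
    lemma₂ = solve-∀

  -- The bound is attained: `n + n (n - 1) + n n (n - 1) / 2` equals `n n (n + 1) / 2`.
  initial-room : n + pot n (pred n) ≤ n ^ 2 * (n + 1) / 2
  initial-room = ≤-reflexive (≡.trans (≡.sym (m*n/n≡m (n + pot n (pred n)) 2)) (≡.cong (_/ 2) twice))
    where
    aux : ∀ m p → 2 * p + suc m * suc m ≡ 2 * (suc m * m) + suc m * suc m * suc m →
          (suc m + p) * 2 ≡ suc m ^ 2 * (suc m + 1)
    aux m p eq = ℕ.+-cancelʳ-≡ (suc m * suc m) _ _ (≡.trans (lemma₁ m p)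
                   (≡.trans (≡.cong (2 * suc m +_) eq) (lemma₂ m)))
      where
      lemma₁ : ∀ m p → (suc m + p) * 2 + suc m * suc m ≡ 2 * suc m + (2 * p + suc m * suc m)
      lemma₁ = solve-∀
      lemma₂ : ∀ m → 2 * suc m + (2 * (suc m * m) + suc m * suc m * suc m) ≡
                     (suc m * (suc m * 1)) * (suc m + 1) + suc m * suc m
      lemma₂ = solve-∀
    aux′ : ∀ n p → 2 * p + n * n ≡ 2 * (n * pred n) + n * n * n → (n + p) * 2 ≡ n ^ 2 * (n + 1)
    aux′ zero    zero _ = refl
    aux′ (suc m) p eq = aux m p eq
    twice : (n + pot n (pred n)) * 2 ≡ n ^ 2 * (n + 1)
    twice = aux′ n (pot n (pred n)) (2*pot n (pred n))

  initial : ∀ {C₁ C₂ : Code n k} → Generates G C₁ → Generates F C₂ →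
            PermutationallyEquivalent C₁ C₂ → ∀ {rs U} → rs ʳ++ [] ≡ allFin n → U ↭ₚ allFin n →
            Invariant rs [] (allFin n) (allFin n) U [] (pred n)
  initial generatesG generatesF (π , maps) {rs} {U} order U↭ = record
    { sound    = λ {T} match → [] ,
        ↭-trans (lift g rs↭)
          (↭-trans (perm match) (lift (λ l → T ▹ f l) (↭ₚ-sym U↭)))
    ; current  =
        let T , T′ , matches = image⇒matches {G = G} {F} {π}
              (image-cong π generatesG generatesF maps) in
        T , T′ , matches⇒match {φ = id} {id} matches
    -- Before any copies are added the bound says `n ≤ suc e`; `pred n` is the least `e` that
    -- satisfies it.
    ; bounded  = λ v → ℕ.+-monoʳ-≤ (occG v) (n≤ n)
    ; fresh    = λ v _ → ≤-refl
    ; order    = order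
    ; partition = ↭ₚ-trans (↭ₚ-reflexive (++-identityʳ U)) U↭
    ; coversˡ  = ∈-allFin
    ; coversʳ  = ∈-allFin
    ; balanced = refl
    ; room     = ≡.subst₂ (λ a b → a + pot b (pred n) ≤ n ^ 2 * (n + 1) / 2) (≡.sym (length-tabulate id))
                   (≡.sym length-rs) initial-room
    ; small    = ℕ.+-mono-≤ ℕ.pred[n]≤n (≤-reflexive (≡.cong (n *_) length-rs))
    }
    where
    n≤ : ∀ n → n ≤ suc (pred n)
    n≤ zero    = z≤n
    n≤ (suc n) = ≤-refl
    rs↭ : rs ↭ₚ allFin n
    rs↭ = ↭ₚ-trans (↭ₚ-reflexive (≡.sym (++-identityʳ rs)))
            (↭ₚ-trans (Propositionalₚ.++↭ʳ++ rs []) (↭ₚ-reflexive order))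
    length-rs : length rs ≡ n
    length-rs = ≡.trans (Propositionalₚ.↭-length rs↭) (length-tabulate id)

-- τ and κ bound the number of steps and of queries.

module Triples {g : Level} (O : Oracle) (Good : 𝔻 → Set g) where

  record Run {v p} (prog : Com v) (σ : Store v) (τ κ : ℕ) (Post : Store v → Set p) : Set (g ⊔ p) where
    constructor run
    field
      {final}   : Store v
      {time}    : ℕ
      {queries} : List 𝔻
      exec      : O ⊢⟨ prog ∣ σ ⟩⇓⟨ final ∣ time ∣ queries ⟩
      time≤     : time ≤ τ
      count≤    : length queries ≤ κ
      good      : All Good queries
      post      : Post final

  module _ {v : ℕ} {p : Level} {Post : Store v → Set p} where

    run-mono : ∀ {m} {Pre : Store v → Set m} {prog σ τ κ} → (∀ {σ′} → Pre σ′ → Post σ′) →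
               Run prog σ τ κ Pre → Run prog σ τ κ Post
    run-mono f (run exec t c g q) = run exec t c g (f q)

    run-assign : ∀ {x e σ} → Post (σ [ x ]≔ eval e σ) → Run (x := e) σ (1 + cost e) 0 Post
    run-assign post = run assign ≤-refl z≤n [] post

    run-call : ∀ {x e σ} → Good (eval e σ) → Post (σ [ x ]≔ encodeBool (O (eval e σ))) →
               Run (x :=oracle e) σ (1 + cost e) 1 Post
    run-call good post = run call ≤-refl ≤-refl (good ∷ []) post

    weaken : ∀ {prog σ τ τ′ κ κ′} → τ ≤ τ′ → κ ≤ κ′ → Run prog σ τ κ Post → Run prog σ τ′ κ′ Post
    weaken τ≤ κ≤ (run exec t≤ c≤ good post) = run exec (≤-trans t≤ τ≤) (≤-trans c≤ κ≤) good post

    infixr 5 _then_ _↣_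

    _then_ : ∀ {m} {Mid : Store v → Set m} {p₁ p₂ σ τ₁ τ₂ κ₁ κ₂} → Run p₁ σ τ₁ κ₁ Mid →
             (∀ {σ′} → Mid σ′ → Run p₂ σ′ τ₂ κ₂ Post) → Run (p₁ ⨾ p₂) σ (τ₁ + τ₂) (κ₁ + κ₂) Post
    run {queries = qs₁} exec₁ t₁ c₁ g₁ q₁ then next with next q₁
    ... | run exec₂ t₂ c₂ g₂ q₂ = run (seq exec₁ exec₂) (ℕ.+-mono-≤ t₁ t₂)
      (≤-trans (≤-reflexive (length-++ qs₁)) (ℕ.+-mono-≤ c₁ c₂)) (Allₚ.++⁺ g₁ g₂) q₂

    -- An assignment determines the next store, so no intermediate condition has to be named.
    _↣_ : ∀ x {e p₂ σ τ κ} → Run p₂ (σ [ x ]≔ eval e σ) τ κ Post →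
          Run (x := e ⨾ p₂) σ (1 + cost e + τ) κ Post
    x ↣ run exec t c g q = run (seq assign exec) (ℕ.+-monoʳ-≤ _ t) c g q

    run-if-true : ∀ {e p₁ p₂ σ a b τ κ} → eval e σ ≡ cons a b → Run p₁ σ τ κ Post →
                  Run (if e then p₁ else p₂) σ (1 + cost e + τ) κ Post
    run-if-true eq (run exec t c g q) = run (if-true eq exec) (ℕ.+-monoʳ-≤ _ t) c g q

    run-if-false : ∀ {e p₁ p₂ σ τ κ} → eval e σ ≡ nil → Run p₂ σ τ κ Post →
                   Run (if e then p₁ else p₂) σ (1 + cost e + τ) κ Post
    run-if-false eq (run exec t c g q) = run (if-false eq exec) (ℕ.+-monoʳ-≤ _ t) c g q

    run-while-false : ∀ {e prog σ} → eval e σ ≡ nil → Post σ →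
                      Run (while e loop prog) σ (1 + cost e) 0 Post
    run-while-false eq post = run (while-false eq) ≤-refl z≤n [] post

    run-while-true : ∀ {m} {Mid : Store v → Set m} {e prog σ a b τ₁ τ₂ κ₁ κ₂} → eval e σ ≡ cons a b →
                     Run prog σ τ₁ κ₁ Mid →
                     (∀ {σ′} → Mid σ′ → Run (while e loop prog) σ′ τ₂ κ₂ Post) →
                     Run (while e loop prog) σ (1 + cost e + (τ₁ + τ₂)) (κ₁ + κ₂) Post
    run-while-true {e = e} eq (run {queries = qs₁} exec₁ t₁ c₁ g₁ q₁) next with next q₁
    ... | run exec₂ t₂ c₂ g₂ q₂ = run (while-true eq exec₁ exec₂)
      (ℕ.+-monoʳ-≤ (1 + cost e) (ℕ.+-mono-≤ t₁ t₂))
      (≤-trans (≤-reflexive (length-++ qs₁)) (ℕ.+-mono-≤ c₁ c₂)) (Allₚ.++⁺ g₁ g₂) q₂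

-- The program

module Algorithm where

  -- K is a list whose length is the number of copies to add, N a list of length n; the entries of
  -- U and V are pairs of an index in unary and a column of F.  Loading reverses the order of the
  -- columns of G, so that the images, each put in front of the list X, end up in the right order.

  vars : ℕ
  vars = 17

  pattern X     = 0F
  pattern Rest  = 1F
  pattern GX    = 2F
  pattern FX    = 3F
  pattern U     = 4F
  pattern W     = 5F
  pattern K     = 6F
  pattern N     = 7F
  pattern Dup   = 8F
  pattern P     = 9F
  pattern V     = suc 9F
  pattern Found = suc (suc 9F)
  pattern A     = suc (suc (suc 9F))
  pattern B     = suc (suc (suc (suc 9F)))
  pattern T     = suc (suc (suc (suc (suc 9F))))
  pattern Ans   = suc (suc (suc (suc (suc (suc 9F)))))
  pattern C     = suc (suc (suc (suc (suc (suc (suc 9F))))))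

  load copy query scanUsed scanUnused update grow stage initialise main : Com vars

  load = while var P loop
    ( Rest := cons (hd (var T)) (var Rest)
    ⨾ U := cons (cons (var A) (hd (var P))) (var U)
    ⨾ A := cons nil (var A)
    ⨾ T := tl (var T)
    ⨾ P := tl (var P))

  copy = while var T loop
    ( A := cons (hd (var Rest)) (var A)
    ⨾ B := cons (var C) (var B)
    ⨾ T := tl (var T))

  query =
      A := var GX
    ⨾ B := var FX
    ⨾ T := var K
    ⨾ copy
    ⨾ Ans :=oracle cons (var A) (var B)

  scanUsed = while var P loop
    ( C := hd (var P)
    ⨾ query
    -- The second branch stands for an empty command. Once set, `Dup` stays set.
    ⨾ (if var Ans then (Dup := var Ans) else (Dup := var Dup))
    ⨾ P := tl (var P))

  scanUnused = while var P loop
    -- `Found` receives a whole entry, which is a `cons` and hence counts as true even if its index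
    -- is zero.
    ( (if var Found
       then (V := cons (hd (var P)) (var V))
       else ( C := tl (hd (var P))
            ⨾ query
            ⨾ (if var Ans then (Found := hd (var P)) else (V := cons (hd (var P)) (var V)))))
    ⨾ P := tl (var P))

  -- Once `Found` is set no further query is made, so `A` and `B` still hold the enlarged lists of
  -- the accepted query.
  update = if var Dup then (Dup := nil) else (GX := var A ⨾ FX := var B)

  grow = while var T loop
    ( K := cons nil (var K)
    ⨾ T := tl (var T))

  stage =
      Dup := nil
    ⨾ P := var W
    ⨾ scanUsed
    ⨾ V := nil
    ⨾ Found := nil
    ⨾ P := var U
    ⨾ scanUnused
    ⨾ update
    ⨾ X := cons (hd (var Found)) (var X)
    ⨾ W := cons (tl (var Found)) (var W)
    ⨾ U := var V
    ⨾ T := var N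
    ⨾ grow
    ⨾ Rest := tl (var Rest)

  initialise =
      GX := hd (var X)
    ⨾ FX := tl (var X)
    ⨾ N := tl (var X)
    -- A list of length `pred n`, the number of copies in the first stage; for `n = 0` the tail of
    -- `nil` is `nil`.
    ⨾ K := tl (var N)
    ⨾ T := var GX
    ⨾ P := var N
    ⨾ X := nil
    ⨾ load

  main = initialise ⨾ while var Rest loop stage

  program : Program
  program = record { extraVars = 16 ; body = main }

-- Verification of the program and its running time

module Correctness {c ℓ : Level} {q : ℕ} (𝔽 : FiniteField c ℓ q)
  (O : Oracle) (oracle : Codes.DecidesPCE 𝔽 O) {n k : ℕ} (C₁ C₂ : Codes.Code 𝔽 n k)
  (G F : Codes.Matrix 𝔽 k n)
  (generatesG : Codes.Generates 𝔽 G C₁) (generatesF : Codes.Generates 𝔽 F C₂) where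

  open Codes 𝔽
  open Algorithm
  open Linear 𝔽
  open Reduction 𝔽 G F
  open Propositional using ()
    renaming (_↭_ to _↭ₚ_; ↭-sym to ↭ₚ-sym; ↭-trans to ↭ₚ-trans; ↭-reflexive to ↭ₚ-reflexive)

  Good : 𝔻 → Set (lsuc (c ⊔ ℓ))
  Good w = Σ ℕ λ m → m ≤ n ^ 2 * (n + 1) / 2 × EncodesCodePair m k w

  open Triples O Good

  columnCode : Matrix k n → Fin n → 𝔻
  columnCode M j = encodeVector encodeElement (columns M j)

  index : Fin n → 𝔻
  index = encodeUnary ∘ toℕ

  entry : Fin n → 𝔻
  entry l = cons (index l) (columnCode F l)

  record State : Set where
    field
      rest gx fx unused used : List (Fin n)
      counter : List 𝔻
      dup ptr kept found a b t ans col : 𝔻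

  open State

  -- The component `used` fills both `X` and `W`, which keeps the output indices in step with the
  -- used columns; `N` never changes after initialisation.
  ⟦_⟧ : State → Store vars
  ⟦ s ⟧ =
    encodeList (map index (used s)) ∷
    columnList G (rest s) ∷
    columnList G (gx s) ∷
    columnList F (fx s) ∷
    encodeList (map entry (unused s)) ∷
    columnList F (used s) ∷
    encodeList (counter s) ∷
    columnList F (allFin n) ∷
    dup s ∷ ptr s ∷ kept s ∷ found s ∷ a s ∷ b s ∷ t s ∷ ans s ∷ col s ∷ []

  At : State → Store vars → Set
  At s σ = σ ≡ ⟦ s ⟧

  -- The loop conses copies onto an accumulator, whereas `pin` puts a block of copies in front; this
  -- reconciles the two.
  pin-∷ : ∀ e (r : Fin n) as → pin e r (r ∷ as) ≡ r ∷ pin e r as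
  pin-∷ zero    r as = refl
  pin-∷ (suc e) r as = ≡.cong (r ∷_) (pin-∷ e r as)

  copying : State → (r : Fin n) (rs : List (Fin n)) (l : Fin n) (as bs : List (Fin n)) (t : 𝔻) → State
  copying s r rs l as bs t = record s
    { rest = r ∷ rs ; a = columnList G as ; b = columnList F bs ; t = t ; col = columnCode F l }

  -- Each copy costs 2 for the test and 5, 4 and 3 for the assignments; the last test costs 2.
  run-copy : ∀ ts s r rs l as bs →
    Run copy ⟦ copying s r rs l as bs (encodeList ts) ⟧ (length ts * 14 + 2) 0
        (At (copying s r rs l (pin (length ts) r as) (pin (length ts) l bs) nil))
  run-copy []       s r rs l as bs = run-while-false refl refl
  run-copy (t ∷ ts) s r rs l as bs =
    run-while-true {Mid = At (copying s r rs l (r ∷ as) (l ∷ bs) (encodeList ts))} refl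
      (A ↣ B ↣ run-assign refl) λ { refl →
      ≡.subst₂ (λ as′ bs′ → Run copy ⟦ copying s r rs l (r ∷ as) (l ∷ bs) (encodeList ts) ⟧
                   (length ts * 14 + 2) 0 (At (copying s r rs l as′ bs′ nil)))
        (pin-∷ (length ts) r as) (pin-∷ (length ts) l bs)
        (run-copy ts s r rs l (r ∷ as) (l ∷ bs)) }

  -- Nested like the program, so that the composed budget agrees with it by computation.
  queryTime : ℕ → ℕ
  queryTime e = 2 + (2 + (2 + (e * 14 + 2 + 4)))

  Holds : State → List (Fin n) → Set (c ⊔ ℓ)
  Holds s done = Invariant (rest s) done (gx s) (fx s) (unused s) (used s) (length (counter s))

  ʳ++↭ : ∀ (as : List (Fin n)) → as ʳ++ [] ↭ₚ as
  ʳ++↭ as = ↭ₚ-trans (↭ₚ-sym (Propositionalₚ.++↭ʳ++ as [])) (↭ₚ-reflexive (++-identityʳ as))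

  length-all : length (map (columnCode F) (allFin n)) ≡ n
  length-all = ≡.trans (length-map (columnCode F) (allFin n)) (length-tabulate id)

  run-grow : ∀ ts s →
    Run grow ⟦ record s { t = encodeList ts } ⟧ (length ts * 9 + 2) 0
        (λ σ → ∃ λ ks → length ks ≡ length ts + length (counter s) ×
               At (record s { counter = ks ; t = nil }) σ)
  run-grow []       s = run-while-false refl (counter s , refl , refl)
  run-grow (t ∷ ts) s =
    run-while-true {Mid = At (record s { counter = nil ∷ counter s ; t = encodeList ts })} refl
      (K ↣ run-assign refl) λ { refl →
      run-mono (λ { (ks , eq , at) → ks , ≡.trans eq (ℕ.+-suc (length ts) _) , at })
        (run-grow ts (record s { counter = nil ∷ counter s })) }

  module Stage {r : Fin n} {rs done G⁺ F⁺ us ws : List (Fin n)} {ks : List 𝔻}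
    (inv : Invariant (r ∷ rs) done G⁺ F⁺ us ws (length ks)) where

    open Invariant inv

    e : ℕ
    e = length ks

    Asks : Fin n → Set (c ⊔ ℓ)
    Asks = Query inv

    Answer : Fin n → Bool → Set (c ⊔ ℓ)
    Answer l true  = Asks l
    Answer l false = ¬ Asks l

    -- The components that stay constant while the two scans run.
    fixed : State → State
    fixed s = record s { rest = r ∷ rs ; gx = G⁺ ; fx = F⁺ ; unused = us ; used = ws ; counter = ks }

    asked : State → Fin n → Bool → State
    asked s l v = record (fixed s)
      { a = columnList G (pin e r G⁺) ; b = columnList F (pin e l F⁺)
      ; t = nil ; ans = encodeBool v ; col = columnCode F l }

    answer : ∀ l → Answer l (O (pairList (pin e r G⁺) (pin e l F⁺)))
    answer l with O (pairList (pin e r G⁺) (pin e l F⁺))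
                | decides {C₁} {C₂} generatesG generatesF {O} oracle (balanced-pin inv l)
                    (covers-pin inv r coversˡ) (covers-pin inv l coversʳ)
    ... | true  | iff = Equivalence.to iff refl
    ... | false | iff = λ asks → contradiction (Equivalence.from iff asks) λ ()

    run-query : ∀ s l →
      Run query ⟦ record (fixed s) { col = columnCode F l } ⟧ (queryTime e) 1
          (λ σ → ∃ λ v → Answer l v × σ ≡ ⟦ asked s l v ⟧)
    run-query s l = A ↣ B ↣ T ↣ run-copy ks (fixed s) r rs l G⁺ F⁺ then λ { refl →
      run-call
        ( length (pin e r G⁺)
        , ≤-trans (ℕ.m≤m+n _ _) (room-pin inv)
        , isQuery {C₁} {C₂} generatesG generatesF (balanced-pin inv l)
            (covers-pin inv r coversˡ) (covers-pin inv l coversʳ))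
        (_ , answer l , refl) }

    run-judge : ∀ s x vs v d → Answer x v → Seen inv vs d →
      Run (if var Ans then (Dup := var Ans) else (Dup := var Dup))
          ⟦ record (asked s x v) { dup = encodeBool d } ⟧ 4 0
          (λ σ → ∃ λ d′ → Seen inv (x ∷ vs) d′ × At (record (asked s x v) { dup = encodeBool d′ }) σ)
    run-judge s x vs true  d     asks seen = run-if-true refl (run-assign (true , here asks , refl))
    run-judge s x vs false true  ¬asks seen = run-if-false refl (run-assign (true , there seen , refl))
    run-judge s x vs false false ¬asks seen = run-if-false refl (run-assign (false , ¬asks ∷ seen , refl))

    checking : State → List (Fin n) → Bool → State
    checking s xs d = record (fixed s) { dup = encodeBool d ; ptr = columnList F xs }

    run-scanUsed : ∀ xs vs d s → Seen inv vs d →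
      Run scanUsed ⟦ checking s xs d ⟧ (length xs * (queryTime e + 12) + 2) (length xs)
          (λ σ → ∃₂ λ d′ s′ → Seen inv (xs ʳ++ vs) d′ × At (checking s′ [] d′) σ)
    run-scanUsed []       vs d s seen = run-while-false refl (d , s , seen , refl)
    run-scanUsed (x ∷ xs) vs d s seen = weaken (≤-reflexive (lemma (queryTime e) (length xs))) ≤-refl
      (run-while-true {Mid = λ σ → ∃₂ λ d′ s′ → Seen inv (x ∷ vs) d′ × At (checking s′ xs d′) σ} refl
        (C ↣ run-query (checking s (x ∷ xs) d) x then λ { (v , ans , refl) →
         run-judge (checking s (x ∷ xs) d) x vs v d ans seen then λ { (d′ , seen′ , refl) →
         run-assign (d′ , asked (checking s (x ∷ xs) d) x v , seen′ , refl) } })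
        λ { (d′ , s′ , seen′ , refl) → run-scanUsed xs (x ∷ vs) d′ s′ seen′ })
      where
      lemma : ∀ q l → 2 + ((3 + (q + (4 + 3))) + (l * (q + 12) + 2)) ≡ suc l * (q + 12) + 2
      lemma = solve-∀

    searching : State → List (Fin n) → List (Fin n) → 𝔻 → State
    searching s xs vs d = record (fixed s)
      { ptr = encodeList (map entry xs) ; kept = encodeList (map entry vs) ; found = d }

    run-keep : ∀ xs vs l s →
      Run scanUnused ⟦ searching s xs vs (entry l) ⟧ (length xs * 12 + 2) 0
          (At (searching s [] (xs ʳ++ vs) (entry l)))
    run-keep []       vs l s = run-while-false refl refl
    run-keep (x ∷ xs) vs l s =
      run-while-true {Mid = At (searching s xs (x ∷ vs) (entry l))} refl
        (run-if-true {Post = At (searching s (x ∷ xs) (x ∷ vs) (entry l))} refl (run-assign refl) then λ { refl →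
         run-assign refl })
        λ { refl → run-keep xs (x ∷ vs) l s }

    Outcome : State → Fin n → List (Fin n) → List (Fin n) → Store vars → Set (c ⊔ ℓ)
    Outcome s x xs vs σ = (Asks x × At (searching (asked s x true) xs vs (entry x)) σ)
                       ⊎ (¬ Asks x × At (searching (asked s x false) xs (x ∷ vs) nil) σ)

    run-choose : ∀ s x xs vs v → Answer x v →
      Run (if var Ans then (Found := hd (var P)) else (V := cons (hd (var P)) (var V)))
          ⟦ searching (asked s x v) (x ∷ xs) vs nil ⟧ 7 0 (Outcome s x (x ∷ xs) vs)
    run-choose s x xs vs true  asks  = weaken (ℕ.m≤n+m _ 2) z≤n (run-if-true refl (run-assign (inj₁ (asks , refl))))
    run-choose s x xs vs false ¬asks = run-if-false refl (run-assign (inj₂ (¬asks , refl)))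

    -- The search cannot fail: `Any Asks xs`, supplied by `candidate`, excludes the empty list and
    -- passes to the tail after a rejection. `dup s′ ≡ dup s` preserves the result of the first
    -- scan.
    run-scanUnused : ∀ xs vs s → Any Asks xs →
      Run scanUnused ⟦ searching s xs vs nil ⟧ (length xs * (queryTime e + 18) + 2) (length xs)
          (λ σ → ∃₂ λ l vs′ → ∃ λ s′ → dup s′ ≡ dup s × Asks l × l ∷ vs′ ↭ₚ xs ++ vs ×
                 At (searching (asked s′ l true) [] vs′ (entry l)) σ)
    run-scanUnused (x ∷ xs) vs s some =
      weaken (≤-reflexive (lemma (queryTime e) (length xs))) ≤-refl
      (run-while-true {Mid = Outcome s′ x xs vs} refl
        (run-if-false refl (C ↣ run-query s′ x then λ { (v , ans , refl) →
           run-choose s′ x xs vs v ans })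
         then λ { (inj₁ (asks , refl))  → run-assign (inj₁ (asks , refl))
                ; (inj₂ (¬asks , refl)) → run-assign (inj₂ (¬asks , refl)) })
        λ { (inj₁ (asks , refl)) → weaken
              (ℕ.+-monoˡ-≤ 2 (ℕ.*-monoʳ-≤ (length xs) 12≤))
              z≤n
              (run-mono (λ { refl → x , xs ʳ++ vs , s′ , refl , asks ,
                 Propositional.prep x (↭ₚ-sym (Propositionalₚ.++↭ʳ++ xs vs)) , refl })
              (run-keep xs vs x (asked s′ x true)))
          ; (inj₂ (¬asks , refl)) → run-mono
              (λ { (l , vs′ , s″ , same , asks , perm , eq) →
                l , vs′ , s″ , same , asks , ↭ₚ-trans perm (Propositionalₚ.shift x xs vs) , eq })
              (run-scanUnused xs (x ∷ vs) (asked s′ x false) (Any.tail ¬asks some)) })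
      where
      s′ = searching s (x ∷ xs) vs nil
      12≤ : 12 ≤ queryTime e + 18
      12≤ = ≤-trans (ℕ.m≤n+m 12 (queryTime e + 6)) (≤-reflexive (ℕ.+-assoc (queryTime e) 6 12))
      lemma : ∀ q l → 2 + ((2 + (4 + (q + 7)) + 3) + (l * (q + 18) + 2)) ≡ suc l * (q + 18) + 2
      lemma = solve-∀

    run-update : ∀ s l d →
      Run update ⟦ record (asked s l true) { dup = encodeBool d } ⟧ 6 0
          (At (record (asked s l true) { dup = nil ; gx = pinUnless d e r G⁺ ; fx = pinUnless d e l F⁺ }))
    run-update s l true  = weaken (ℕ.m≤n+m 4 2) z≤n (run-if-true refl (run-assign refl))
    run-update s l false = run-if-false refl (GX ↣ run-assign refl)

    seen-all : ∀ d → Seen inv (ws ʳ++ []) d → Seen inv ws d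
    seen-all true  = Propositionalₚ.Any-resp-↭ (ʳ++↭ ws)
    seen-all false = Propositionalₚ.All-resp-↭ (ʳ++↭ ws)

    stage-time : ∀ {u w m} q → u + w ≡ n → m ≡ n →
      2 + (2 + (w * (q + 12) + 2 + (2 + (2 + (2 + (u * (q + 18) + 2 +
        (6 + (5 + (5 + (2 + (2 + (m * 9 + 2 + 3))))))))))))
      ≤ n * (q + 27) + 39
    stage-time {u} {w} q refl refl = ≤-trans (ℕ.m≤m+n _ (w * 6)) (≤-reflexive (lemma u w q))
      where
      lemma : ∀ u w q → 2 + (2 + (w * (q + 12) + 2 + (2 + (2 + (2 + (u * (q + 18) + 2 +
                (6 + (5 + (5 + (2 + (2 + ((u + w) * 9 + 2 + 3)))))))))))) + w * 6
              ≡ (u + w) * (q + 27) + 39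
      lemma = solve-∀

    us+ws : length us + length ws ≡ n
    us+ws = ≡.trans (≡.sym (length-++ us)) (≡.trans (Propositionalₚ.↭-length partition) (length-tabulate id))

    queries≤ : length ws + (length us + 0) ≤ n
    queries≤ = ≤-reflexive (≡.trans (≡.cong (length ws +_) (ℕ.+-identityʳ (length us)))
      (≡.trans (ℕ.+-comm (length ws) (length us)) us+ws))

    run-stage : ∀ s → Run stage ⟦ fixed s ⟧ (n * (queryTime e + 27) + 39) n
      (λ σ → ∃ λ s′ → Holds (record s′ { rest = rs }) (r ∷ done) × At (record s′ { rest = rs }) σ)
    run-stage s = weaken (stage-time {length us} {length ws} (queryTime e) us+ws length-all) queries≤
      (Dup ↣ P ↣ run-scanUsed ws [] false s [] then λ { (d , s₁ , seen , refl) →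
       V ↣ Found ↣ P ↣ run-scanUnused us [] (checking s₁ [] d) (candidate inv)
       then λ { (l , vs , s₂ , same , asks , perm , refl) →
       -- The flag found by `scanUsed` is carried past `scanUnused` by `same`.
       ≡.subst (λ δ → Run update ⟦ record (chosen s₂ l vs) { dup = δ } ⟧ 6 0
                 (At (record (chosen s₂ l vs)
                   { dup = nil ; gx = pinUnless d e r G⁺ ; fx = pinUnless d e l F⁺ })))
         (≡.sym same) (run-update (chosen s₂ l vs) l d) then λ { refl →
       X ↣ W ↣ U ↣ T ↣
       run-grow (map (columnCode F) (allFin n)) (grown s₂ l vs d) then λ { (ks′ , len , refl) →
       run-assign (record (grown s₂ l vs d) { counter = ks′ ; t = nil } ,
         ≡.subst (Invariant rs (r ∷ done) (pinUnless d e r G⁺) (pinUnless d e l F⁺) vs (l ∷ ws))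
           (≡.trans (≡.cong (_+ e) (≡.sym length-all)) (≡.sym len))
           (step inv d (seen-all d seen) asks (↭ₚ-trans perm (↭ₚ-reflexive (++-identityʳ us)))) ,
         refl) } } } })
      where
      chosen : State → Fin n → List (Fin n) → State
      chosen s l vs = searching (asked s l true) [] vs (entry l)
      grown : State → Fin n → List (Fin n) → Bool → State
      grown s l vs d = record (chosen s l vs)
        { dup = nil ; gx = pinUnless d e r G⁺ ; fx = pinUnless d e l F⁺ ; unused = vs ; used = l ∷ ws }

  Final : Store vars → Set (c ⊔ ℓ)
  Final σ = ∃ λ s → Holds (record s { rest = [] }) (allFin n) × At (record s { rest = [] }) σ

  -- The time of a stage with its loop test, with `n * n` put for the number of copies.
  stageTime : ℕ
  stageTime = n * (n * n * 14 + 39) + 41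

  stage-time≤ : ∀ {e m} → e + n * suc m ≤ n + n * n → 2 + (n * (queryTime e + 27) + 39) ≤ stageTime
  stage-time≤ {e} {m} small = begin
    2 + (n * (queryTime e + 27) + 39) ≡⟨ lemma₁ n e ⟩
    n * (e * 14 + 39) + 41            ≤⟨ ℕ.+-monoˡ-≤ 41 (ℕ.*-monoʳ-≤ n (ℕ.+-monoˡ-≤ 39 (ℕ.*-monoˡ-≤ 14 e≤))) ⟩
    stageTime                         ∎
    where
    open ℕ.≤-Reasoning
    lemma₁ : ∀ n e → 2 + (n * (2 + (2 + (2 + (e * 14 + 2 + 4))) + 27) + 39) ≡ n * (e * 14 + 39) + 41
    lemma₁ = solve-∀
    lemma₂ : ∀ n e m → n + (e + n * m) ≡ e + n * suc m
    lemma₂ = solve-∀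
    -- At least one column is left, so one `n` can be cancelled in `small`.
    e≤ : e ≤ n * n
    e≤ = ≤-trans (ℕ.m≤m+n e (n * m))
      (ℕ.+-cancelˡ-≤ n _ _ (≤-trans (≤-reflexive (lemma₂ n e m)) small))

  run-stages : ∀ rs {done} s → Holds (record s { rest = rs }) done →
    Run (while var Rest loop stage) ⟦ record s { rest = rs } ⟧
        (length rs * stageTime + 2) (length rs * n) Final
  run-stages []       {done} s inv = run-while-false refl
    -- For an empty `rs`, `order` reduces to `done ≡ allFin n`.
    (s , ≡.subst (Holds (record s { rest = [] })) (Invariant.order inv) inv , refl)
  run-stages (r ∷ rs) {done} s inv = weaken
    (≤-trans (≤-reflexive (lemma 2 (n * (queryTime (length (counter s)) + 27) + 39) (length rs * stageTime)))
      (ℕ.+-monoˡ-≤ 2 (ℕ.+-monoˡ-≤ (length rs * stageTime)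
        (stage-time≤ {length (counter s)} (Invariant.small inv)))))
    ≤-refl
    (run-while-true refl (Stage.run-stage {ks = counter s} inv s)
      λ { (s′ , inv′ , refl) → run-stages rs s′ inv′ })
    where
    lemma : ∀ a b c → a + (b + (c + 2)) ≡ a + b + c + 2
    lemma = solve-∀

  loading : State → (rs us as : List (Fin n)) → ℕ → State
  loading s rs us as i = record s
    { rest = rs ; unused = us ; a = encodeUnary i ; t = columnList G as ; ptr = columnList F as }

  -- Generalised from `allFin n` to a run of consecutive indices starting at `i`, because the unary
  -- counter in `A` has to agree with the index of the head.
  run-load : ∀ {m} (h : Fin m → Fin n) i → (∀ j → toℕ (h j) ≡ i + toℕ j) → ∀ s rs us →
    Run load ⟦ loading s rs us (tabulate h) i ⟧ (m * 24 + 2) 0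
        (λ σ → ∃ λ i′ → At (loading s (tabulate h ʳ++ rs) (tabulate h ʳ++ us) [] i′) σ)
  run-load {zero}  h i consecutive s rs us = run-while-false refl (i , refl)
  run-load {suc m} h i consecutive s rs us =
    run-while-true {Mid = At (loading s (h zero ∷ rs) (h zero ∷ us) (tabulate (h ∘ suc)) (suc i))} refl
      -- The machine stores its counter `encodeUnary i`; `head-index` identifies it with the index
      -- of the column.
      (Rest ↣ U ↣ A ↣ T ↣ run-assign (≡.subst
        (λ x → At (loading s (h zero ∷ rs) (h zero ∷ us) (tabulate (h ∘ suc)) (suc i)) (stored x))
        head-index refl))
      λ { refl → run-load (h ∘ suc) (suc i)
            (λ j → ≡.trans (consecutive (suc j)) (ℕ.+-suc i (toℕ j))) s (h zero ∷ rs) (h zero ∷ us) }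
    where
    head-index : index (h zero) ≡ encodeUnary i
    head-index = ≡.cong encodeUnary (≡.trans (consecutive zero) (ℕ.+-identityʳ i))
    stored : 𝔻 → Store vars
    stored x = ⟦ loading s (h zero ∷ rs) us (tabulate (h ∘ suc)) (suc i) ⟧ [ U ]≔
      cons (cons x (columnCode F (h zero))) (encodeList (map entry us))

  tail-encodeList : ∀ xs → tail𝔻 (encodeList xs) ≡ encodeList (List.drop 1 xs)
  tail-encodeList []       = refl
  tail-encodeList (x ∷ xs) = refl

  blank : List 𝔻 → State
  blank ks = record
    { rest = [] ; gx = allFin n ; fx = allFin n ; unused = [] ; used = [] ; counter = ks
    ; dup = nil ; ptr = nil ; kept = nil ; found = nil
    ; a = nil ; b = nil ; t = nil ; ans = nil ; col = nil }

  ks₀ : List 𝔻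
  ks₀ = List.drop 1 (map (columnCode F) (allFin n))

  length-ks₀ : length ks₀ ≡ pred n
  length-ks₀ = ≡.trans (length-drop 1 (map (columnCode F) (allFin n))) (≡.cong pred length-all)

  run-initialise : Run initialise (pairList (allFin n) (allFin n) ∷ Vec.replicate 16 nil) (18 + (n * 24 + 2)) 0
    (λ σ → ∃ λ i → At (loading (blank ks₀) (allFin n ʳ++ []) (allFin n ʳ++ []) [] i) σ)
  run-initialise = GX ↣ FX ↣ N ↣ K ↣ T ↣ P ↣ X ↣
    ≡.subst (λ x → Run load (⟦ loading (blank ks₀) [] [] (allFin n) 0 ⟧ [ K ]≔ x) (n * 24 + 2) 0
               (λ σ → ∃ λ i → At (loading (blank ks₀) (allFin n ʳ++ []) (allFin n ʳ++ []) [] i) σ))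
      (≡.sym (tail-encodeList (map (columnCode F) (allFin n))))
      (run-load id 0 (λ _ → refl) (blank ks₀) [] [])

  run-main : PermutationallyEquivalent C₁ C₂ →
    Run main (pairList (allFin n) (allFin n) ∷ Vec.replicate 16 nil)
        (20 + n * 24 + (n * stageTime + 2)) (n * n) Final
  run-main equivalent = weaken (≤-reflexive (lemma n stageTime)) (≤-reflexive (≡.cong (_* n) length-rs))
    (run-initialise then λ { (i , refl) →
      weaken (≤-reflexive (≡.cong (λ m → m * stageTime + 2) length-rs)) ≤-refl
        (run-stages rs (loading (blank ks₀) rs rs [] i)
          (≡.subst (Invariant rs [] (allFin n) (allFin n) rs []) (≡.sym length-ks₀)
            (initial {C₁} {C₂} generatesG generatesF equivalent
              (≡.trans (ʳ++-ʳ++ (allFin n)) (++-identityʳ (allFin n))) (ʳ++↭ (allFin n))))) })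
    where
    rs = allFin n ʳ++ []
    length-rs : length rs ≡ n
    length-rs = ≡.trans (Propositionalₚ.↭-length (ʳ++↭ (allFin n))) (length-tabulate id)
    lemma : ∀ n s → 18 + (n * 24 + 2) + (n * s + 2) ≡ 20 + n * 24 + (n * s + 2)
    lemma = solve-∀

  length≤size : ∀ xs → suc (length xs) ≤ size (encodeList xs)
  length≤size []       = ≤-refl
  length≤size (x ∷ xs) = s≤s (≤-trans (length≤size xs) (ℕ.m≤n+m _ (size x)))

  n<size : n < size (pairList (allFin n) (allFin n))
  n<size = ≡.subst (λ m → suc m ≤ size (pairList (allFin n) (allFin n))) length-all
    (ℕ.m≤n⇒m≤1+n (≤-trans (length≤size (map (columnCode F) (allFin n)))
      (ℕ.m≤n+m _ (size (columnList G (allFin n))))))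

  -- The time is a polynomial of degree 4 in `n` whose coefficients 22, 24, 14, 39 and 41 sum to
  -- 140, and each of its monomials is at most `s ^ 4`.
  total-time≤ : ∀ s → n < s → 20 + n * 24 + (n * stageTime + 2) ≤ 140 * s ^ 4
  total-time≤ s n<s = begin
    20 + n * 24 + (n * (n * (n * n * 14 + 39) + 41) + 2)
      ≡⟨ lemma₁ n ⟩
    22 * 1 + 24 * n + 14 * (n * n * (n * n)) + 39 * (n * n) + 41 * n
      ≤⟨ ℕ.+-mono-≤ (ℕ.+-mono-≤ (ℕ.+-mono-≤ (ℕ.+-mono-≤
           (ℕ.*-monoʳ-≤ 22 1≤) (ℕ.*-monoʳ-≤ 24 n≤))
           (ℕ.*-monoʳ-≤ 14 (≤-trans (ℕ.*-mono-≤ n²≤ n²≤) (≤-reflexive (lemma₂ s)))))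
           (ℕ.*-monoʳ-≤ 39 (≤-trans n²≤ s²≤))) (ℕ.*-monoʳ-≤ 41 n≤) ⟩
    22 * s ^ 4 + 24 * s ^ 4 + 14 * s ^ 4 + 39 * s ^ 4 + 41 * s ^ 4
      ≡⟨ lemma₃ (s ^ 4) ⟩
    140 * s ^ 4 ∎
    where
    open ℕ.≤-Reasoning
    lemma₁ : ∀ n → 20 + n * 24 + (n * (n * (n * n * 14 + 39) + 41) + 2)
                   ≡ 22 * 1 + 24 * n + 14 * (n * n * (n * n)) + 39 * (n * n) + 41 * n
    lemma₁ = solve-∀
    lemma₂ : ∀ s → s * s * (s * s) ≡ s * (s * (s * (s * 1)))
    lemma₂ = solve-∀
    lemma₃ : ∀ p → 22 * p + 24 * p + 14 * p + 39 * p + 41 * p ≡ 140 * p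
    lemma₃ = solve-∀
    instance
      s≢0 : NonZero s
      s≢0 = >-nonZero (≤-trans (s≤s z≤n) n<s)
    n²≤ : n * n ≤ s * s
    n²≤ = ℕ.*-mono-≤ (ℕ.<⇒≤ n<s) (ℕ.<⇒≤ n<s)
    s²≤ : s * s ≤ s ^ 4
    s²≤ = ≤-trans (ℕ.m≤m*n (s * s) (s * s) {{ℕ.m*n≢0 s s}}) (≤-reflexive (lemma₂ s))
    n≤ : n ≤ s ^ 4
    n≤ = ≤-trans (≤-trans (ℕ.<⇒≤ n<s) (ℕ.m≤m*n s s)) s²≤
    1≤ : 1 ≤ s ^ 4
    1≤ = ≤-trans (≤-trans (s≤s z≤n) n<s) (≤-trans (ℕ.m≤m*n s s) s²≤)

  encoded : encodeInstance G F ≡ pairList (allFin n) (allFin n)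
  encoded = ≡.sym (≡.cong₂ cons (columnList-select G id) (columnList-select F id))

  Solved : 𝔻 → Set (lsuc (c ⊔ ℓ))
  Solved input = Σ (Permutation′ n) λ π → Σ ℕ λ t → Σ (List 𝔻) λ qs →
    Runs O program input (encodePermutation π) t qs
    × Maps π C₁ C₂
    × t ≤ 140 * size input ^ 4
    × length qs ≤ n ^ 2
    × All Good qs

  output : ∀ {σ} → Final σ →
           ∃ λ (π : Permutation′ n) → σ ≡ encodePermutation π ∷ Vec.tail σ × Maps π C₁ C₂
  output (s , holds , refl) =
    let _ , _ , π , used≡ , matches = finish holds in
    π ,
    ≡.cong (_∷ Vec.tail ⟦ record s { rest = [] } ⟧)
      (≡.cong encodeList (≡.trans (≡.cong (map index) used≡) (map-tabulate (π ⟨$⟩ʳ_) index))) ,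
    image-cong π (≐-sym generatesG) (≐-sym generatesF) (matches⇒image matches)

  solved : PermutationallyEquivalent C₁ C₂ → Solved (pairList (allFin n) (allFin n))
  solved equivalent =
    π , time , queries ,
    (Vec.tail final , ≡.subst (λ σ → O ⊢⟨ main ∣ _ ⟩⇓⟨ σ ∣ time ∣ queries ⟩) final≡ exec) ,
    maps ,
    ≤-trans time≤ (total-time≤ (size (pairList (allFin n) (allFin n))) n<size) ,
    ≤-trans count≤ (≤-reflexive (≡.cong (n *_) (≡.sym (ℕ.*-identityʳ n)))) ,
    good
    where
    open Run (run-main equivalent)
    π      = proj₁ (output post)
    final≡ = proj₁ (proj₂ (output post))
    maps   = proj₂ (proj₂ (output post))

theorem1 : ∀ {c ℓ : Level} →
    Σ Program λ A → Σ ℕ λ a → Σ ℕ λ e →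
    ∀ {q : ℕ} (𝔽 : FiniteField c ℓ q) → let open Codes 𝔽 in
    ∀ (O : Oracle) → DecidesPCE O →
    ∀ {n k d : ℕ} (C₁ C₂ : Code n k) →
    HasMinimumDistance C₁ d → HasMinimumDistance C₂ d →
    ∀ (G F : Matrix k n) → Generates G C₁ → Generates F C₂ →
    PermutationallyEquivalent C₁ C₂ →
    Σ (Permutation′ n) λ π → Σ ℕ λ t → Σ (List 𝔻) λ qs →
    Runs O A (encodeInstance G F) (encodePermutation π) t qs
    × Maps π C₁ C₂
    × t ≤ a * size (encodeInstance G F) ^ e
    × length qs ≤ n ^ 2
    × All (λ w → Σ ℕ λ m → m ≤ n ^ 2 * (n + 1) / 2 × EncodesCodePair m k w) qs
theorem1 = Algorithm.program , 140 , 4 , λ 𝔽 O oracle C₁ C₂ _ _ G F generatesG generatesF →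
  λ equivalent → let open Correctness 𝔽 O oracle C₁ C₂ G F generatesG generatesF in
  ≡.subst Solved (≡.sym encoded) (solved equivalent)
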